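{- Let $L$ be a countable bounded distributive lattice. Then $L$ is not a Heyting algebra if and only if there is $i\in\{1,2,3\}$ such that $L_i$ is a homomorphic image of $L$ via an onto bounded lattice homomorphism $h_i\colon L\to L_i$ with the following property: there are $a,b\in L$ such that $h_i[I_{a\to b}]=I_{c_i\to 0}$, where $c_1=c$, $c_2=\{0\}$, and $c_3=(\varnothing,1)$.
   Context: A bounded distributive lattice $L$ is a Heyting algebra if for all $a,b\in L$ there is an element $a\to b\in L$ such that for all $x\in L$: $a\wedge x\le b$ iff $x\le a\to b$. "Countable" includes finite. For a bounded distributive lattice $L$ and $a,b\in L$, define the ideal $I_{a\to b}:=\{d\in L\mid d\wedge a\le b\}$. In $I_{c_i\to 0}$, this is computed in $L_i$, with $0$ the bottom of $L_i$. $h_i[I_{a\to b}]$ denotes the direct image. The lattices $L_1,L_2,L_3$ and the elements $c_i\in L_i$ are as follows. - $L_1$: let $Z_1=\{x,y\}\cup\{z_n\mid n\in\omega\}$ be the one-point compactification of the countable discrete space $\{y\}\cup\{z_n\mid n\in\omega\}$, with $x$ the added point, partially ordered by $x<y$, $z_0>z_1>z_2>\cdots$, $x<z_n$ for all $n$, and no other strict relations. $L_1$ is the lattice (under inclusion) of clopen upsets of $Z_1$; explicitly its elements are $\varnothing$, $\{y\}$, ${\uparrow}z_n=\{z_0,\dots,z_n\}$, ${\uparrow}z_n\cup\{y\}$ ($n\in\omega$), and $Z_1$. The element $c\in L_1$ is $\{y\}$. - $L_2$: the lattice $\mathcal{P}_{\rm fin}(\omega)$ of finite subsets of $\omega$ ordered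 by inclusion, together with an added top element. Here $c_2=\{0\}\in\mathcal{P}_{\rm fin}(\omega)$ is the singleton of the number $0\in\omega$. - $L_3$: let ${\bf CF}(\omega)$ be the Boolean algebra of finite and cofinite subsets of $\omega$ and ${\bf 2}=\{0,1\}$ the two-element Boolean algebra. $L_3$ is the bounded sublattice of ${\bf CF}(\omega)\times{\bf 2}$ consisting of the pairs $(A,n)$ such that $A$ is finite or $n=1$. Here $c_3=(\varnothing,1)$. -}

module Defs where

open import Algebra.Core using (Op₂)
open import Algebra.Definitions using (_DistributesOverˡ_)
open import Algebra.Lattice.Bundles using (RawLattice)
open import Algebra.Lattice.Morphism.Structures using (module LatticeMorphisms)
open import Algebra.Morphism.Definitions using (Homomorphic₀)
open import Data.Bool.Base as Bool using (Bool; true; false; T; not)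
import Data.Bool.Properties as Bool
open import Data.Fin.Base using (Fin; zero; suc)
open import Data.List.Base using (List; []; _∷_; _++_)
open import Data.List.Membership.Propositional using (_∈_)
open import Data.List.Membership.Propositional.Properties using (∈-++⁺ˡ; ∈-++⁺ʳ)
open import Data.List.Relation.Unary.Any using (here)
open import Data.Nat.Base as ℕ using (ℕ)
open import Data.Product.Base using (Σ; ∃; _×_; _,_; proj₁; proj₂; zip)
open import Data.Product.Relation.Binary.Pointwise.NonDependent
  using (Pointwise; ×-isPartialOrder)
open import Data.Sum.Base using (_⊎_; inj₁; inj₂; [_,_]′)
open import Data.Unit.Base using (tt)
open import Function.Base using (_∘_)
open import Function.Bundles using (Injection; module Equivalence)
open import Function.Definitions using (Surjective)
open import Level using (Level; _⊔_; 0ℓ) renaming (suc to lsuc)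
open import Relation.Binary.Construct.Closure.Reflexive using (ReflClosure)
import Relation.Binary.Construct.Add.Supremum.Equality as Equality⁺
import Relation.Binary.Construct.Add.Supremum.NonStrict as NonStrict⁺
import Relation.Binary.Construct.On as On
open import Relation.Binary.Core using (Rel)
open import Relation.Binary.Definitions using (Minimum; _Respects_)
open import Relation.Binary.Lattice.Bundles
  using (BoundedLattice; DistributiveLattice)
open import Relation.Binary.Lattice.Structures
  using (IsHeytingAlgebra; IsLattice)
open import Relation.Binary.PropositionalEquality.Core using (_≡_; refl)
open import Relation.Binary.PropositionalEquality.Properties
  using () renaming (setoid to ≡-setoid)
open import Relation.Nullary.Construct.Add.Supremum using (_⁺; ⊤⁺; [_])
open import Relation.Unary using (Pred)

private
  variable
    a c ℓ₁ ℓ₂ d e₁ e₂ p : Level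

record BoundedDistributiveLattice c ℓ₁ ℓ₂ : Set (lsuc (c ⊔ ℓ₁ ⊔ ℓ₂)) where
  field
    boundedLattice : BoundedLattice c ℓ₁ ℓ₂
  open BoundedLattice boundedLattice public
  field
    ∧-distribˡ-∨ : _DistributesOverˡ_ _≈_ _∧_ _∨_

  distributiveLattice : DistributiveLattice c ℓ₁ ℓ₂
  distributiveLattice = record
    { isDistributiveLattice = record
      { isLattice = isLattice ; ∧-distribˡ-∨ = ∧-distribˡ-∨ } }

  rawLattice : RawLattice c ℓ₁
  rawLattice = record { _≈_ = _≈_ ; _∧_ = _∧_ ; _∨_ = _∨_ }

-- Bounded lattices are nonempty, so embeddability into ℕ is countability
-- (finite included).
Countable : BoundedDistributiveLattice c ℓ₁ ℓ₂ → Set (c ⊔ ℓ₁)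
Countable L = Injection setoid (≡-setoid ℕ)
  where open BoundedDistributiveLattice L

IsHeyting : BoundedDistributiveLattice c ℓ₁ ℓ₂ → Set (c ⊔ ℓ₁ ⊔ ℓ₂)
IsHeyting L =
  Σ (Op₂ Carrier) λ _⇨_ → IsHeytingAlgebra _≈_ _≤_ _∨_ _∧_ _⇨_ ⊤ ⊥
  where open BoundedDistributiveLattice L

module _ (L : BoundedDistributiveLattice c ℓ₁ ℓ₂) where
  open BoundedDistributiveLattice L

  -- The ideal I_{a→b}.
  Ideal : Carrier → Carrier → Pred Carrier ℓ₂
  Ideal a b d = d ∧ a ≤ b

module _ (L : BoundedDistributiveLattice c ℓ₁ ℓ₂)
         (M : BoundedDistributiveLattice d e₁ e₂) where
  private
    module L = BoundedDistributiveLattice L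
    module M = BoundedDistributiveLattice M
  open LatticeMorphisms L.rawLattice M.rawLattice using (IsLatticeHomomorphism)

  record IsOntoBoundedLatticeHomomorphism (h : L.Carrier → M.Carrier)
         : Set (c ⊔ ℓ₁ ⊔ d ⊔ e₁) where
    field
      isLatticeHomomorphism : IsLatticeHomomorphism h
      ⊤-homo                : Homomorphic₀ L.Carrier M.Carrier M._≈_ h L.⊤ M.⊤
      ⊥-homo                : Homomorphic₀ L.Carrier M.Carrier M._≈_ h L.⊥ M.⊥
      surjective            : Surjective L._≈_ M._≈_ h

    open IsLatticeHomomorphism isLatticeHomomorphism public

  image : (L.Carrier → M.Carrier) → Pred L.Carrier p → Pred M.Carrier (c ⊔ e₁ ⊔ p)
  image h P y = ∃ λ x → P x × h x M.≈ y

module _ (D : DistributiveLattice c ℓ₁ ℓ₂) where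
  open DistributiveLattice D

  sublattice : (P : Pred Carrier p) →
               (∀ {x y} → P x → P y → P (x ∨ y)) →
               (∀ {x y} → P x → P y → P (x ∧ y)) →
               DistributiveLattice (c ⊔ p) ℓ₁ ℓ₂
  sublattice P ∨-closed ∧-closed = record
    { Carrier = Σ Carrier P
    ; _≈_ = λ x y → proj₁ x ≈ proj₁ y
    ; _≤_ = λ x y → proj₁ x ≤ proj₁ y
    ; _∨_ = zip _∨_ ∨-closed
    ; _∧_ = zip _∧_ ∧-closed
    ; isDistributiveLattice = record
      { isLattice = record
        { isPartialOrder = On.isPartialOrder proj₁ isPartialOrder
        ; supremum = λ (x , _) (y , _) →
            x≤x∨y x y , y≤x∨y x y , λ _ → ∨-least
        ; infimum = λ (x , _) (y , _) →
            x∧y≤x x y , x∧y≤y x y , λ _ → ∧-greatest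
        }
      ; ∧-distribˡ-∨ = λ (x , _) (y , _) (z , _) → ∧-distribˡ-∨ x y z
      }
    }

  addTop : (⊥ : Carrier) → Minimum _≤_ ⊥ →
           BoundedDistributiveLattice c (c ⊔ ℓ₁) (c ⊔ ℓ₂)
  addTop ⊥ minimum = record
    { boundedLattice = record
      { _≈_ = _≈⁺_ ; _≤_ = _≤⁺_ ; _∨_ = _∨⁺_ ; _∧_ = _∧⁺_ ; ⊤ = ⊤⁺ ; ⊥ = [ ⊥ ]
      ; isBoundedLattice = record
        { isLattice = record
          { isPartialOrder = ≤⁺-isPartialOrder isPartialOrder
          ; supremum = supremum⁺
          ; infimum = infimum⁺
          }
        ; maximum = _≤⊤⁺
        ; minimum = λ { [ x ] → [ minimum x ] ; ⊤⁺ → [ ⊥ ] ≤⊤⁺ }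
        }
      }
    ; ∧-distribˡ-∨ = distrib⁺
    }
    where
    open Equality⁺ _≈_ using (_≈⁺_; [_]; ⊤⁺≈⊤⁺; ≈⁺-refl)
    open NonStrict⁺ _≤_ using (_≤⁺_; [_]; _≤⊤⁺; ≤⁺-isPartialOrder)

    _∨⁺_ _∧⁺_ : Op₂ (Carrier ⁺)
    [ x ] ∨⁺ [ y ] = [ x ∨ y ]
    [ x ] ∨⁺ ⊤⁺    = ⊤⁺
    ⊤⁺    ∨⁺ _     = ⊤⁺
    [ x ] ∧⁺ [ y ] = [ x ∧ y ]
    [ x ] ∧⁺ ⊤⁺    = [ x ]
    ⊤⁺    ∧⁺ y     = y

    refl⁺ : ∀ x → x ≤⁺ x
    refl⁺ [ x ] = [ DistributiveLattice.refl D ]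
    refl⁺ ⊤⁺    = ⊤⁺ ≤⊤⁺

    supremum⁺ : ∀ x y → x ≤⁺ (x ∨⁺ y) × y ≤⁺ (x ∨⁺ y) ×
                ∀ z → x ≤⁺ z → y ≤⁺ z → (x ∨⁺ y) ≤⁺ z
    supremum⁺ [ x ] [ y ] = [ x≤x∨y x y ] , [ y≤x∨y x y ] , λ where
      [ z ] [ x≤z ] [ y≤z ] → [ ∨-least x≤z y≤z ]
      ⊤⁺    _       _       → [ x ∨ y ] ≤⊤⁺
    supremum⁺ [ x ] ⊤⁺ = ([ x ] ≤⊤⁺) , (⊤⁺ ≤⊤⁺) , λ _ _ ⊤≤z → ⊤≤z
    supremum⁺ ⊤⁺    y  = (⊤⁺ ≤⊤⁺) , (y ≤⊤⁺) , λ _ ⊤≤z _ → ⊤≤z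

    infimum⁺ : ∀ x y → (x ∧⁺ y) ≤⁺ x × (x ∧⁺ y) ≤⁺ y ×
               ∀ z → z ≤⁺ x → z ≤⁺ y → z ≤⁺ (x ∧⁺ y)
    infimum⁺ [ x ] [ y ] = [ x∧y≤x x y ] , [ x∧y≤y x y ] , λ where
      [ z ] [ z≤x ] [ z≤y ] → [ ∧-greatest z≤x z≤y ]
    infimum⁺ [ x ] ⊤⁺ = refl⁺ [ x ] , ([ x ] ≤⊤⁺) , λ _ z≤x _ → z≤x
    infimum⁺ ⊤⁺    y  = (y ≤⊤⁺) , refl⁺ y , λ _ _ z≤y → z≤y

    -- x ∧ (y ∨ ⊤) = x = (x ∧ y) ∨ x, and symmetrically
    absorbʳ : ∀ x y → x ≈ (x ∧ y) ∨ x
    absorbʳ x y = antisym (y≤x∨y (x ∧ y) x)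
                          (∨-least (x∧y≤x x y) (DistributiveLattice.refl D))

    absorbˡ : ∀ x y → x ≈ x ∨ (x ∧ y)
    absorbˡ x y = antisym (x≤x∨y x (x ∧ y))
                          (∨-least (DistributiveLattice.refl D) (x∧y≤x x y))

    idem : ∀ x → x ≈ x ∨ x
    idem x = antisym (x≤x∨y x x)
                     (∨-least (DistributiveLattice.refl D) (DistributiveLattice.refl D))

    distrib⁺ : _DistributesOverˡ_ _≈⁺_ _∧⁺_ _∨⁺_
    distrib⁺ [ x ] [ y ] [ z ] = [ ∧-distribˡ-∨ x y z ]
    distrib⁺ [ x ] [ y ] ⊤⁺    = [ absorbʳ x y ]
    distrib⁺ [ x ] ⊤⁺    [ z ] = [ absorbˡ x z ]
    distrib⁺ [ x ] ⊤⁺    ⊤⁺    = [ idem x ]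
    distrib⁺ ⊤⁺    y     z     = ≈⁺-refl Eq.refl

module _ (L : BoundedDistributiveLattice c ℓ₁ ℓ₂) where
  open BoundedDistributiveLattice L

  boundedSublattice : (P : Pred Carrier p) →
                      (∀ {x y} → P x → P y → P (x ∨ y)) →
                      (∀ {x y} → P x → P y → P (x ∧ y)) →
                      P ⊤ → P ⊥ →
                      BoundedDistributiveLattice (c ⊔ p) ℓ₁ ℓ₂
  boundedSublattice P ∨-closed ∧-closed ⊤∈P ⊥∈P = record
    { boundedLattice = record
      { ⊤ = ⊤ , ⊤∈P
      ; ⊥ = ⊥ , ⊥∈P
      ; isBoundedLattice = record
        { isLattice = Sub.isLattice
        ; maximum   = λ (x , _) → maximum x
        ; minimum   = λ (x , _) → minimum x
        }
      }
    ; ∧-distribˡ-∨ = Sub.∧-distribˡ-∨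
    }
    where
    module Sub =
      DistributiveLattice (sublattice distributiveLattice P ∨-closed ∧-closed)

_×ᴸ_ : BoundedDistributiveLattice c ℓ₁ ℓ₂ → BoundedDistributiveLattice d e₁ e₂ →
       BoundedDistributiveLattice (c ⊔ d) (ℓ₁ ⊔ e₁) (ℓ₂ ⊔ e₂)
L ×ᴸ M = record
  { boundedLattice = record
    { _≈_ = Pointwise L._≈_ M._≈_
    ; _≤_ = Pointwise L._≤_ M._≤_
    ; _∨_ = zip L._∨_ M._∨_
    ; _∧_ = zip L._∧_ M._∧_
    ; ⊤ = L.⊤ , M.⊤
    ; ⊥ = L.⊥ , M.⊥
    ; isBoundedLattice = record
      { isLattice = record
        { isPartialOrder = ×-isPartialOrder L.isPartialOrder M.isPartialOrder
        ; supremum = λ (x , x′) (y , y′) →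
            (L.x≤x∨y x y , M.x≤x∨y x′ y′) ,
            (L.y≤x∨y x y , M.y≤x∨y x′ y′) ,
            λ _ (p , p′) (q , q′) → L.∨-least p q , M.∨-least p′ q′
        ; infimum = λ (x , x′) (y , y′) →
            (L.x∧y≤x x y , M.x∧y≤x x′ y′) ,
            (L.x∧y≤y x y , M.x∧y≤y x′ y′) ,
            λ _ (p , p′) (q , q′) → L.∧-greatest p q , M.∧-greatest p′ q′
        }
      ; maximum = λ (x , x′) → L.maximum x , M.maximum x′
      ; minimum = λ (x , x′) → L.minimum x , M.minimum x′
      }
    }
  ; ∧-distribˡ-∨ = λ (x , x′) (y , y′) (z , z′) →
      L.∧-distribˡ-∨ x y z , M.∧-distribˡ-∨ x′ y′ z′
  }
  where
  module L = BoundedDistributiveLattice L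
  module M = BoundedDistributiveLattice M

𝟚 : BoundedDistributiveLattice 0ℓ 0ℓ 0ℓ
𝟚 = record
  { boundedLattice = record
    { _≈_ = _≡_ ; _≤_ = Bool._≤_ ; _∨_ = Bool._∨_ ; _∧_ = Bool._∧_
    ; ⊤ = true ; ⊥ = false
    ; isBoundedLattice = record
      { isLattice = isLattice
      ; maximum = Bool.≤-maximum
      ; minimum = Bool.≤-minimum
      }
    }
  ; ∧-distribˡ-∨ = Bool.∧-distribˡ-∨
  }
  where
  isLattice : IsLattice _≡_ Bool._≤_ Bool._∨_ Bool._∧_
  isLattice = record
    { isPartialOrder = Bool.≤-isPartialOrder
    ; supremum = λ where
        false y → Bool.≤-minimum y , Bool.≤-refl , λ _ _ y≤z → y≤z
        true  y → Bool.≤-refl , Bool.≤-maximum y , λ _ x≤z _ → x≤z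
    ; infimum = λ where
        false y → Bool.≤-refl , Bool.≤-minimum y , λ _ z≤x _ → z≤x
        true  y → Bool.≤-maximum y , Bool.≤-refl , λ _ _ z≤y → z≤y
    }

-- Subsets are represented by characteristic functions, so that the powerset
-- lattice is 𝟚 to the power A and x is a member of U when T (U x).
℘ : Set a → BoundedDistributiveLattice a a a
℘ A = record
  { boundedLattice = record
    { Carrier = A → Bool
    ; _≈_ = λ U V → ∀ x → U x ≡ V x
    ; _≤_ = λ U V → ∀ x → U x Bool.≤ V x
    ; _∨_ = λ U V x → U x Bool.∨ V x
    ; _∧_ = λ U V x → U x Bool.∧ V x
    ; ⊤ = λ _ → true
    ; ⊥ = λ _ → false
    ; isBoundedLattice = record
      { isLattice = record
        { isPartialOrder = record
          { isPreorder = record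
            { isEquivalence = record
              { refl  = λ _ → 𝟚.Eq.refl
              ; sym   = λ p x → 𝟚.Eq.sym (p x)
              ; trans = λ p q x → 𝟚.Eq.trans (p x) (q x)
              }
            ; reflexive = λ p x → 𝟚.reflexive (p x)
            ; trans     = λ p q x → 𝟚.trans (p x) (q x)
            }
          ; antisym = λ p q x → 𝟚.antisym (p x) (q x)
          }
        ; supremum = λ U V →
            (λ x → 𝟚.x≤x∨y (U x) (V x)) ,
            (λ x → 𝟚.y≤x∨y (U x) (V x)) ,
            λ _ p q x → 𝟚.∨-least (p x) (q x)
        ; infimum = λ U V →
            (λ x → 𝟚.x∧y≤x (U x) (V x)) ,
            (λ x → 𝟚.x∧y≤y (U x) (V x)) ,
            λ _ p q x → 𝟚.∧-greatest (p x) (q x)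
        }
      ; maximum = λ U x → 𝟚.maximum (U x)
      ; minimum = λ U x → 𝟚.minimum (U x)
      }
    }
  ; ∧-distribˡ-∨ = λ U V W x → 𝟚.∧-distribˡ-∨ (U x) (V x) (W x)
  }
  where module 𝟚 = BoundedDistributiveLattice 𝟚

module _ {A : Set a} where
  open BoundedDistributiveLattice (℘ A)
    using () renaming (_∨_ to _∪_; _∧_ to _∩_; ⊤ to full; ⊥ to ∅)

  ∁ : (A → Bool) → (A → Bool)
  ∁ U = not ∘ U

  Finite Cofinite : Pred (A → Bool) a
  Finite U   = ∃ λ (xs : List A) → ∀ {x} → T (U x) → x ∈ xs
  Cofinite U = Finite (∁ U)

  private
    ∨⁻ : ∀ {x y} → T (x Bool.∨ y) → T x ⊎ T y
    ∨⁻ = Equivalence.to Bool.T-∨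

    ∧⁻ : ∀ {x y} → T (x Bool.∧ y) → T x × T y
    ∧⁻ = Equivalence.to Bool.T-∧

    ¬∨⁻ : ∀ x y → T (not (x Bool.∨ y)) → T (not x) × T (not y)
    ¬∨⁻ false false _ = tt , tt

    ¬∧⁻ : ∀ x y → T (not (x Bool.∧ y)) → T (not x) ⊎ T (not y)
    ¬∧⁻ false _     _ = inj₁ tt
    ¬∧⁻ true  false _ = inj₂ tt

  finite-⊆ : ∀ {U V} → (∀ {x} → T (U x) → T (V x)) → Finite V → Finite U
  finite-⊆ U⊆V (xs , V⊆xs) = xs , λ u → V⊆xs (U⊆V u)

  finite-⊆∪ : ∀ {U V W} → (∀ {x} → T (U x) → T (V x) ⊎ T (W x)) →
              Finite V → Finite W → Finite U
  finite-⊆∪ {U} {V} {W} U⊆V∪W (xs , V⊆xs) (ys , W⊆ys) = xs ++ ys , λ u →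
    [ (λ v → ∈-++⁺ˡ (V⊆xs v)) , (λ w → ∈-++⁺ʳ xs (W⊆ys w)) ]′ (U⊆V∪W u)

  finite-∅ : Finite ∅
  finite-∅ = [] , λ ()

  finite-∪ : ∀ {U V} → Finite U → Finite V → Finite (U ∪ V)
  finite-∪ {U} {V} = finite-⊆∪ {U ∪ V} {U} {V} ∨⁻

  finite-∩ˡ : ∀ {U V} → Finite U → Finite (U ∩ V)
  finite-∩ˡ {U} {V} = finite-⊆ {U ∩ V} {U} (proj₁ ∘ ∧⁻)

  finite-∩ʳ : ∀ {U V} → Finite V → Finite (U ∩ V)
  finite-∩ʳ {U} {V} = finite-⊆ {U ∩ V} {V} (proj₂ ∘ ∧⁻ {U _})

  cofinite-full : Cofinite full
  cofinite-full = finite-∅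

  cofinite-∩ : ∀ {U V} → Cofinite U → Cofinite V → Cofinite (U ∩ V)
  cofinite-∩ {U} {V} = finite-⊆∪ {∁ (U ∩ V)} {∁ U} {∁ V} (¬∧⁻ (U _) (V _))

  cofinite-∪ˡ : ∀ {U V} → Cofinite U → Cofinite (U ∪ V)
  cofinite-∪ˡ {U} {V} = finite-⊆ {∁ (U ∪ V)} {∁ U} (proj₁ ∘ ¬∨⁻ (U _) (V _))

  cofinite-∪ʳ : ∀ {U V} → Cofinite V → Cofinite (U ∪ V)
  cofinite-∪ʳ {U} {V} = finite-⊆ {∁ (U ∪ V)} {∁ V} (proj₂ ∘ ¬∨⁻ (U _) (V _))

------------------------------------------------------------------------
-- L₁: the clopen upsets of Z₁

data Z₁ : Set where
  𝐱 𝐲 : Z₁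
  𝐳   : ℕ → Z₁

data _<₁_ : Rel Z₁ 0ℓ where
  𝐱<𝐲 : 𝐱 <₁ 𝐲
  𝐱<𝐳 : ∀ {n} → 𝐱 <₁ 𝐳 n
  𝐳<𝐳 : ∀ {m n} → m ℕ.< n → 𝐳 n <₁ 𝐳 m

_≤₁_ : Rel Z₁ 0ℓ
_≤₁_ = ReflClosure _<₁_

-- The topology of the one-point compactification, with 𝐱 the point at infinity:
-- every subset of the discrete part is open, and the open neighbourhoods of 𝐱
-- are the complements of the compact, i.e. finite, subsets of the discrete part.
Open Clopen Upset : Pred (Z₁ → Bool) 0ℓ
Open U   = T (U 𝐱) → Cofinite U
Clopen U = Open U × Open (∁ U)
Upset U  = (T ∘ U) Respects _≤₁_

ClopenUpset : Pred (Z₁ → Bool) 0ℓ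
ClopenUpset U = Clopen U × Upset U

L₁ : BoundedDistributiveLattice 0ℓ 0ℓ 0ℓ
L₁ = boundedSublattice (℘ Z₁) ClopenUpset
  (λ {U} {V} → ∪-closed {U} {V}) (λ {U} {V} → ∩-closed {U} {V})
  (((λ _ → cofinite-full {A = Z₁}) , λ ()) , λ _ _ → tt)
  (((λ ()) , λ _ → finite-∅ {A = Z₁}) , λ _ ())
  where
  open BoundedDistributiveLattice (℘ Z₁) using () renaming (_∨_ to _∪_; _∧_ to _∩_)

  -- Open (∁ U) unfolds to: if 𝐱 ∉ U, then ∁ (∁ U) is finite.
  ∁∁⁻ : ∀ {U : Z₁ → Bool} → Finite (∁ (∁ U)) → Finite U
  ∁∁⁻ {U} = finite-⊆ {U = U} {V = ∁ (∁ U)} (λ {w} → into (U w))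
    where
    into : ∀ b → T b → T (not (not b))
    into true _ = tt

  ∁∁⁺ : ∀ {U : Z₁ → Bool} → Finite U → Finite (∁ (∁ U))
  ∁∁⁺ {U} = finite-⊆ {U = ∁ (∁ U)} {V = U} (λ {w} → out (U w))
    where
    out : ∀ b → T (not (not b)) → T b
    out true _ = tt

  ∪-closed : ∀ {U V} → ClopenUpset U → ClopenUpset V → ClopenUpset (U ∪ V)
  ∪-closed {U} {V} ((oU , cU) , uU) ((oV , cV) , uV) = (open-∪ , closed-∪) , up
    where
    open-∪ : Open (U ∪ V)
    open-∪ = [ cofinite-∪ˡ {U = U} {V} ∘ oU , cofinite-∪ʳ {U = U} {V} ∘ oV ]′
           ∘ Equivalence.to Bool.T-∨

    closed-∪ : Open (∁ (U ∪ V))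
    closed-∪ t with U 𝐱 | V 𝐱
    ... | false | false =
      ∁∁⁺ {U ∪ V} (finite-∪ {U = U} {V} (∁∁⁻ {U} (cU tt)) (∁∁⁻ {V} (cV tt)))

    up : Upset (U ∪ V)
    up p≤q = Equivalence.from Bool.T-∨
           ∘ [ inj₁ ∘ uU p≤q , inj₂ ∘ uV p≤q ]′
           ∘ Equivalence.to Bool.T-∨

  ∩-closed : ∀ {U V} → ClopenUpset U → ClopenUpset V → ClopenUpset (U ∩ V)
  ∩-closed {U} {V} ((oU , cU) , uU) ((oV , cV) , uV) = (open-∩ , closed-∩) , up
    where
    open-∩ : Open (U ∩ V)
    open-∩ t = let u , v = Equivalence.to Bool.T-∧ t in
               cofinite-∩ {U = U} {V} (oU u) (oV v)

    closed-∩ : Open (∁ (U ∩ V))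
    closed-∩ t with U 𝐱 | V 𝐱
    ... | false | _     = ∁∁⁺ {U ∩ V} (finite-∩ˡ {U = U} {V} (∁∁⁻ {U} (cU tt)))
    ... | true  | false = ∁∁⁺ {U ∩ V} (finite-∩ʳ {U = U} {V} (∁∁⁻ {V} (cV tt)))

    up : Upset (U ∩ V)
    up p≤q t = let u , v = Equivalence.to Bool.T-∧ t in
               Equivalence.from Bool.T-∧ (uU p≤q u , uV p≤q v)

c₁ : BoundedDistributiveLattice.Carrier L₁
c₁ = ｛𝐲｝ , ((λ ()) , λ _ → 𝐲 ∷ [] , fin) , up
  where
  ｛𝐲｝ : Z₁ → Bool
  ｛𝐲｝ 𝐱     = false
  ｛𝐲｝ 𝐲     = true
  ｛𝐲｝ (𝐳 _) = false

  fin : ∀ {p} → T (∁ (∁ ｛𝐲｝) p) → p ∈ 𝐲 ∷ []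
  fin {𝐲} _ = here refl

  up : Upset ｛𝐲｝
  up ReflClosure.refl       t = t
  up ReflClosure.[ 𝐱<𝐲 ]    _ = tt
  up ReflClosure.[ 𝐱<𝐳 ]    ()
  up ReflClosure.[ 𝐳<𝐳 _ ]  ()

------------------------------------------------------------------------
-- L₂: the finite subsets of ℕ with an added top element

module ℘ℕ = BoundedDistributiveLattice (℘ ℕ)

𝒫fin : DistributiveLattice 0ℓ 0ℓ 0ℓ
𝒫fin = sublattice ℘ℕ.distributiveLattice Finite
  (λ {U} {V} → finite-∪ {U = U} {V}) (λ {U} {V} f _ → finite-∩ˡ {U = U} {V} f)

L₂ : BoundedDistributiveLattice 0ℓ 0ℓ 0ℓ
L₂ = addTop 𝒫fin (℘ℕ.⊥ , finite-∅) (λ (U , _) → ℘ℕ.minimum U)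

c₂ : BoundedDistributiveLattice.Carrier L₂
c₂ = [ (λ n → n ℕ.≡ᵇ 0) , 0 ∷ [] , fin ]
  where
  fin : ∀ {n} → T (n ℕ.≡ᵇ 0) → n ∈ 0 ∷ []
  fin {ℕ.zero} _ = here refl

------------------------------------------------------------------------
-- L₃: the pairs (A , n) in CF(ω) × 𝟚 with A finite or n = 1

CF : BoundedDistributiveLattice 0ℓ 0ℓ 0ℓ
CF = boundedSublattice (℘ ℕ) (λ U → Finite U ⊎ Cofinite U)
  (λ {U} {V} → ∪-closed {U} {V}) (λ {U} {V} → ∩-closed {U} {V})
  (inj₂ cofinite-full) (inj₁ finite-∅)
  where
  open ℘ℕ using () renaming (_∨_ to _∪_; _∧_ to _∩_)

  ∪-closed : ∀ {U V} → Finite U ⊎ Cofinite U → Finite V ⊎ Cofinite V →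
             Finite (U ∪ V) ⊎ Cofinite (U ∪ V)
  ∪-closed {U} {V} (inj₁ f) (inj₁ g) = inj₁ (finite-∪ {U = U} {V} f g)
  ∪-closed {U} {V} (inj₂ f) _        = inj₂ (cofinite-∪ˡ {U = U} {V} f)
  ∪-closed {U} {V} (inj₁ _) (inj₂ g) = inj₂ (cofinite-∪ʳ {U = U} {V} g)

  ∩-closed : ∀ {U V} → Finite U ⊎ Cofinite U → Finite V ⊎ Cofinite V →
             Finite (U ∩ V) ⊎ Cofinite (U ∩ V)
  ∩-closed {U} {V} (inj₁ f) _        = inj₁ (finite-∩ˡ {U = U} {V} f)
  ∩-closed {U} {V} (inj₂ _) (inj₁ g) = inj₁ (finite-∩ʳ {U = U} {V} g)
  ∩-closed {U} {V} (inj₂ f) (inj₂ g) = inj₂ (cofinite-∩ {U = U} {V} f g)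

L₃ : BoundedDistributiveLattice 0ℓ 0ℓ 0ℓ
L₃ = boundedSublattice (CF ×ᴸ 𝟚) P
  (λ {u} {v} → ∨-closed {u} {v}) (λ {u} {v} → ∧-closed {u} {v})
  (inj₂ refl) (inj₁ finite-∅)
  where
  open BoundedDistributiveLattice (CF ×ᴸ 𝟚) using (Carrier; _∨_; _∧_)

  P : Pred Carrier 0ℓ
  P ((A , _) , n) = Finite A ⊎ n ≡ true

  ∨-closed : ∀ {u v} → P u → P v → P (u ∨ v)
  ∨-closed {(U , _) , _} {(V , _) , _} (inj₁ f) (inj₁ g) = inj₁ (finite-∪ {U = U} {V} f g)
  ∨-closed {_ , m} (inj₁ _) (inj₂ refl)  = inj₂ (Bool.∨-zeroʳ m)
  ∨-closed         (inj₂ refl) _         = inj₂ refl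

  ∧-closed : ∀ {u v} → P u → P v → P (u ∧ v)
  ∧-closed {(U , _) , _} {(V , _) , _} (inj₁ f) _        = inj₁ (finite-∩ˡ {U = U} {V} f)
  ∧-closed {(U , _) , _} {(V , _) , _} (inj₂ _) (inj₁ g) = inj₁ (finite-∩ʳ {U = U} {V} g)
  ∧-closed (inj₂ refl) (inj₂ refl) = inj₂ refl

c₃ : BoundedDistributiveLattice.Carrier L₃
c₃ = (BoundedDistributiveLattice.⊥ CF , true) , inj₂ refl

-- The indices 0, 1, 2 stand for 1, 2, 3.
𝕃 : Fin 3 → BoundedDistributiveLattice 0ℓ 0ℓ 0ℓ
𝕃 zero             = L₁
𝕃 (suc zero)       = L₂
𝕃 (suc (suc zero)) = L₃

𝕔 : ∀ i → BoundedDistributiveLattice.Carrier (𝕃 i)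
𝕔 zero             = c₁
𝕔 (suc zero)       = c₂
𝕔 (suc (suc zero)) = c₃

{-# OPTIONS --safe #-}

-- If L is not Heyting, some ideal I = I_{a→b} has no greatest element. Hence
-- (⊤ , ⊥) lies in the family of pairs (u , v) such that for no k ∈ I all d ∈ I
-- satisfy d ∧ u ≤ k ∨ v; running through the countable L, such pairs are refined
-- to neighbourhoods u n ∖ v n shrinking to a prime filter x that misses I but is
-- a limit of prime filters z n meeting I. As x misses I, it extends to a prime
-- filter y containing a but not b. By Ramsey's theorem the z n may be assumed to
-- be a descending chain, an antichain above x or an antichain with no member
-- above x, and restricting to {x, y, z 0, z 1, …} maps L onto L₁, L₂ or L₃.
-- Conversely, in a Heyting algebra every I_{a→b}, and so each of its images under
-- onto homomorphisms, has a greatest element, whereas no I_{cᵢ→0} has one.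

module Submission where

open import Defs
open import Axiom.ExcludedMiddle using (ExcludedMiddle)
open import Data.Product.Base using (∃; ∃₂; _×_)
open import Function.Bundles using (_⇔_)
open import Relation.Nullary.Negation.Core using (¬_)
open import Relation.Unary using (_≐_)

open import Data.Bool.Base as Bool using (Bool; true; false; T; not)
import Data.Bool.Properties as Bool
open import Data.Empty using (⊥-elim)
open import Data.Fin.Base as Fin using ()
open import Data.Nat.Base as ℕ using (ℕ; zero; suc; _⊔_; _<_; z≤n; s≤s)
import Data.Nat.Properties as ℕ
open import Data.List.Base using ([]; _∷_; map; upTo)
open import Data.List.Membership.Propositional using (_∈_)
open import Data.List.Membership.Propositional.Properties using (∈-map⁺; ∈-upTo⁺)
open import Data.List.Relation.Unary.Any using (here; there)
open import Data.Product.Base using (Σ; _,_; proj₁; proj₂)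
open import Data.Sum.Base as Sum using (_⊎_; inj₁; inj₂; [_,_]′)
import Data.Unit.Polymorphic.Base as Poly
open import Function.Base using (_∘_; id)
open import Function.Bundles using (module Injection; module Equivalence; mk⇔)
open import Level using (Level; 0ℓ) renaming (_⊔_ to _⊔ˡ_; suc to lsuc)
open import Relation.Binary.Lattice.Bundles using (DistributiveLattice)
open import Relation.Binary.Construct.Add.Supremum.Equality
  (DistributiveLattice._≈_ 𝒫fin) using ([_]; ⊤⁺≈⊤⁺)
open import Relation.Binary.Construct.Add.Supremum.NonStrict
  (DistributiveLattice._≤_ 𝒫fin) using (_≤⁺_; [_])
open import Relation.Binary.Construct.Closure.Reflexive using (ReflClosure)
open import Relation.Binary.Core using (Rel)
open import Relation.Binary.Definitions using (Transitive; tri<; tri≈; tri>)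
open import Relation.Binary.PropositionalEquality.Core
  using (_≡_; refl; sym; trans; cong; cong₂; subst)
open import Relation.Binary.Lattice.Structures using (IsHeytingAlgebra)
open import Relation.Nullary.Construct.Add.Supremum using (⊤⁺; [_])
open import Relation.Nullary.Decidable.Core using (yes; no)
open import Relation.Unary using (Pred)

private
  variable
    p r : Level

-- Sequences, Boolean values and finite subsets.

successive⇒all : ∀ {s} {S : Set s} {_◁_ : Rel S r} → Transitive _◁_ →
                 (σ : ℕ → S) → (∀ n → σ n ◁ σ (suc n)) →
                 ∀ {m n} → m < n → σ m ◁ σ n
successive⇒all {_◁_ = _◁_} ◁-trans σ σ-step m<n = go (ℕ.≤⇒≤′ m<n)
  where
  go : ∀ {m n} → suc m ℕ.≤′ n → σ m ◁ σ n
  go ℕ.≤′-refl        = σ-step _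
  go (ℕ.≤′-step m<n) = ◁-trans (go m<n) (σ-step _)

Increasing : (ℕ → ℕ) → Set
Increasing f = ∀ {m n} → m < n → f m < f n

increasing⇒≥id : ∀ {f} → Increasing f → ∀ n → n ℕ.≤ f n
increasing⇒≥id f-inc zero    = z≤n
increasing⇒≥id f-inc (suc n) = ℕ.≤-<-trans (increasing⇒≥id f-inc n) (f-inc (ℕ.n<1+n n))

Infinite : Pred ℕ p → Set p
Infinite P = ∀ N → ∃ λ n → N < n × P n

Greatest : ∀ {c ℓ₁ ℓ₂} (M : BoundedDistributiveLattice c ℓ₁ ℓ₂) →
           Pred (BoundedDistributiveLattice.Carrier M) p → Set _
Greatest M P = ∃ λ m → P m × ∀ {w} → P w → w ≤ m
  where open BoundedDistributiveLattice M

true≢false : ∀ {b} → b ≡ true → ¬ b ≡ false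
true≢false refl ()

¬true⇒false : ∀ {b} → ¬ b ≡ true → b ≡ false
¬true⇒false = Bool.¬-not

bool-ext : ∀ {b b′} → (b ≡ true → b′ ≡ true) → (b′ ≡ true → b ≡ true) → b ≡ b′
bool-ext {true}          f g = sym (f refl)
bool-ext {false} {true}  f g = g refl
bool-ext {false} {false} f g = refl

T⇒≡ : ∀ {b} → T b → b ≡ true
T⇒≡ = Equivalence.to Bool.T-≡

≡⇒T : ∀ {b} → b ≡ true → T b
≡⇒T = Equivalence.from Bool.T-≡

not-not : ∀ {b} → b ≡ true → T (not (not b))
not-not refl = _

∧true≤false : ∀ {b} → (b Bool.∧ true) Bool.≤ false → b ≡ false
∧true≤false {false} _ = refl

∧false≤false : ∀ b → (b Bool.∧ false) Bool.≤ false
∧false≤false b = Bool.≤-reflexive (Bool.∧-zeroʳ b)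

true≤⇒≡ : ∀ {b} → true Bool.≤ b → b ≡ true
true≤⇒≡ Bool.b≤b = refl

finite⇒bounded : ∀ {a} {A : Set a} (f : A → ℕ) {U : A → Bool} → Finite U →
                 ∃ λ N → ∀ {x} → T (U x) → f x < N
finite⇒bounded f (xs , U⊆xs) = let N , below = go xs in N , below ∘ U⊆xs
  where
  go : ∀ xs → ∃ λ N → ∀ {x} → x ∈ xs → f x < N
  go []       = 0 , λ ()
  go (x ∷ xs) = let N , below = go xs in suc (f x) ⊔ N , λ where
    (here refl) → ℕ.m≤m⊔n (suc (f x)) N
    (there x∈)  → ℕ.≤-trans (below x∈) (ℕ.m≤n⊔m (suc (f x)) N)

bounded⇒finite : ∀ {U : ℕ → Bool} N → (∀ n → T (U n) → n < N) → Finite U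
bounded⇒finite N below = upTo N , λ {n} u → ∈-upTo⁺ (below n u)

bounded⇒finite-Z₁ : ∀ {U : Z₁ → Bool} N → (∀ n → T (U (𝐳 n)) → n < N) → Finite U
bounded⇒finite-Z₁ {U} N below = 𝐱 ∷ 𝐲 ∷ map 𝐳 (upTo N) , listed
  where
  listed : ∀ {q} → T (U q) → q ∈ 𝐱 ∷ 𝐲 ∷ map 𝐳 (upTo N)
  listed {𝐱}   _ = here refl
  listed {𝐲}   _ = there (here refl)
  listed {𝐳 n} u = there (there (∈-map⁺ 𝐳 (∈-upTo⁺ (below n u))))

-- The value 0 at 𝐱 and 𝐲 is irrelevant: only boundedness on finite sets matters.
index : Z₁ → ℕ
index 𝐱     = 0
index 𝐲     = 0
index (𝐳 n) = n

eventually-false⇒bounded : ∀ {U : ℕ → Bool} {N} → (∀ {n} → N ℕ.≤ n → U n ≡ false) →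
                           ∀ n → T (U n) → n < N
eventually-false⇒bounded {N = N} ev n u with n ℕ.<? N
... | yes n<N = n<N
... | no  n≮N = ⊥-elim (true≢false (T⇒≡ u) (ev (ℕ.≮⇒≥ n≮N)))

-- Classical logic and Ramsey's theorem for pairs.

module Classical (em : ∀ {ℓ} → ExcludedMiddle ℓ) where

  by-contradiction : {A : Set p} → ¬ ¬ A → A
  by-contradiction {A = A} ¬¬a with em {P = A}
  ... | yes a = a
  ... | no ¬a = ⊥-elim (¬¬a ¬a)

  ¬∀⇒∃¬ : ∀ {a} {A : Set a} {P : Pred A p} → ¬ (∀ x → P x) → ∃ λ x → ¬ P x
  ¬∀⇒∃¬ ¬∀ = by-contradiction λ ¬∃ → ¬∀ λ x → by-contradiction λ ¬px → ¬∃ (x , ¬px)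

  ¬⇒× : ∀ {A : Set p} {B : Set r} → ¬ (A → B) → A × ¬ B
  ¬⇒× ¬f = by-contradiction (λ ¬a → ¬f λ a → ⊥-elim (¬a a)) , λ b → ¬f λ _ → b

  Homogeneous : Rel ℕ r → Set r
  Homogeneous R = ∃ λ f → Increasing f ×
    ((∀ {m n} → m < n → R (f m) (f n)) ⊎ (∀ {m n} → m < n → ¬ R (f m) (f n)))

  module _ (R : Rel ℕ r) where

    Above : Pred ℕ r → ℕ → Pred ℕ r
    Above P m n = P n × R m n

    -- The case in which every infinite set has a member with infinitely many `R`-successors in that
    -- set. Restricting to these successors again and again yields points each related to all later
    -- ones.
    module AllRelated
      (pick : ∀ {P} → Infinite P → ∃ λ m → P m × Infinite (Above P m)) where

      State : Set (lsuc r)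
      State = Σ (Pred ℕ r) Infinite

      point : State → ℕ
      point (_ , inf) = proj₁ (pick inf)

      next : State → State
      next (P , inf) = (λ n → m < n × Above P m n) , λ N →
        let n , N⊔m<n , q = proj₂ (proj₂ (pick inf)) (N ⊔ m)
        in  n , ℕ.m⊔n<o⇒m<o N m N⊔m<n , ℕ.m⊔n<o⇒n<o N m N⊔m<n , q
        where m = proj₁ (pick inf)

      σ : ℕ → State
      σ zero    = (λ _ → Poly.⊤) , λ N → suc N , ℕ.n<1+n N , _
      σ (suc k) = next (σ k)

      -- The component `P n` makes the relation transitive: members of later sets remain successors
      -- of every earlier point.
      _◁_ : Rel State r
      (P , inf) ◁ (Q , _) = ∀ n → Q n → m < n × P n × R m n
        where m = proj₁ (pick inf)

      ◁-σ : ∀ {k l} → k < l → σ k ◁ σ l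
      ◁-σ = successive⇒all {_◁_ = _◁_}
        (λ P◁Q Q◁S n s → P◁Q n (proj₁ (proj₂ (Q◁S n s)))) σ (λ _ _ q → q)

      related : ∀ {k l} → k < l → point (σ k) < point (σ l) × R (point (σ k)) (point (σ l))
      related {l = l} k<l =
        let lt , _ , rel = ◁-σ k<l _ (proj₁ (proj₂ (pick (proj₂ (σ l))))) in lt , rel

    module NoneRelated {P : Pred ℕ r} (inf : Infinite P)
      (fin : ∀ m → P m → ¬ Infinite (Above P m)) where

      record State : Set r where
        field
          point     : ℕ
          point∈P   : P point
          bound     : ℕ
          point≤    : point ℕ.≤ bound
          unrelated : ∀ {n} → bound < n → P n → ¬ R point n
      open State

      extend : ∀ B → Σ State λ s → B < point s × B ℕ.≤ bound s
      extend B =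
        let m , B<m , pm = inf B
            -- Beyond `N` no member of `P` is a successor of `m`; the bound `m ⊔ N` lets later
            -- points clear both numbers.
            N , ¬∃ = ¬∀⇒∃¬ (fin m pm)
        in record
             { point     = m
             ; point∈P   = pm
             ; bound     = m ⊔ N
             ; point≤    = ℕ.m≤m⊔n m N
             ; unrelated = λ b pn rel → ¬∃ (_ , ℕ.m⊔n<o⇒n<o m N b , pn , rel)
             } , B<m , ℕ.≤-trans (ℕ.<⇒≤ B<m) (ℕ.m≤m⊔n m N)

      σ : ℕ → State
      σ zero    = proj₁ (extend 0)
      σ (suc k) = proj₁ (extend (bound (σ k)))

      _◁_ : Rel State 0ℓ
      s ◁ t = bound s < point t × bound s ℕ.≤ bound t

      ◁-σ : ∀ {k l} → k < l → σ k ◁ σ l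
      ◁-σ = successive⇒all {_◁_ = _◁_}
        (λ (_ , le) (lt , le′) → ℕ.≤-<-trans le lt , ℕ.≤-trans le le′) σ
        (λ k → proj₂ (extend (bound (σ k))))

      increasing : Increasing (point ∘ σ)
      increasing {k} k<l = ℕ.≤-<-trans (point≤ (σ k)) (proj₁ (◁-σ k<l))

      none : ∀ {k l} → k < l → ¬ R (point (σ k)) (point (σ l))
      none {k} {l} k<l = unrelated (σ k) (proj₁ (◁-σ k<l)) (point∈P (σ l))

    -- One question decides the outcome: is there an infinite set each of whose members has only
    -- finitely many successors in it? If so, choosing greedily past the exceptions avoids `R`; if
    -- not, iterated restriction to successors realises it.
    ramsey : Homogeneous R
    ramsey with em {P = ∃ λ P → Infinite P × (∀ m → P m → ¬ Infinite (Above P m))}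
    ... | yes (P , inf , fin) = point ∘ σ , increasing , inj₂ none
      where
      open NoneRelated inf fin
      open State
    ... | no ¬fin = point ∘ σ , (proj₁ ∘ related) , inj₁ (proj₂ ∘ related)
      where
      pick : ∀ {P} → Infinite P → ∃ λ m → P m × Infinite (Above P m)
      pick inf =
        let m , ¬f = ¬∀⇒∃¬ λ fin → ¬fin (_ , inf , fin)
            pm , ¬¬inf = ¬⇒× ¬f
        in  m , pm , by-contradiction ¬¬inf
      open AllRelated pick

-- Prime filters and ideals of a distributive lattice.

module Lattice {c ℓ₁ ℓ₂} (L : BoundedDistributiveLattice c ℓ₁ ℓ₂) where
  open BoundedDistributiveLattice L
    renaming (refl to ≤-refl; trans to ≤-trans; reflexive to ≤-reflexive)
  open import Relation.Binary.Lattice.Properties.MeetSemilattice meetSemilattice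
    using (∧-monotonic)

  -- `w ≤ w ∧ (s ∨ g) ≈ (w ∧ s) ∨ (w ∧ g)`, and both joinands lie below `s`. Distributivity of `L`
  -- enters through this cut rule.
  cut : ∀ {w s g} → w ≤ s ∨ g → w ∧ g ≤ s → w ≤ s
  cut {w} {s} {g} w≤s∨g w∧g≤s =
    ≤-trans (∧-greatest ≤-refl w≤s∨g)
      (≤-trans (≤-reflexive (∧-distribˡ-∨ w s g)) (∨-least (x∧y≤y w s) w∧g≤s))

  -- Encoded as bounded homomorphisms to `𝟚`, so that evaluation at a family of prime filters is at
  -- once a homomorphism into a power of `𝟚`.
  record PrimeFilter : Set (c ⊔ˡ ℓ₁) where
    field
      char   : Carrier → Bool
      ≈-cong : ∀ {e e′} → e ≈ e′ → char e ≡ char e′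
      ∧-homo : ∀ e e′ → char (e ∧ e′) ≡ char e Bool.∧ char e′
      ∨-homo : ∀ e e′ → char (e ∨ e′) ≡ char e Bool.∨ char e′
      ⊤-homo : char ⊤ ≡ true
      ⊥-homo : char ⊥ ≡ false
  open PrimeFilter public

  infix 4 _∋_ _∌_ _⊆_

  _∋_ _∌_ : PrimeFilter → Carrier → Set
  P ∋ e = char P e ≡ true
  P ∌ e = char P e ≡ false

  _⊆_ : Rel PrimeFilter c
  P ⊆ Q = ∀ {e} → P ∋ e → Q ∋ e

  module _ (P : PrimeFilter) where
    private
      ∧-elim : ∀ {b b′} → b Bool.∧ b′ ≡ true → b ≡ true × b′ ≡ true
      ∧-elim {true} eq = refl , eq

      ∨-elim : ∀ {b b′} → b Bool.∨ b′ ≡ true → b ≡ true ⊎ b′ ≡ true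
      ∨-elim {true}  _  = inj₁ refl
      ∨-elim {false} eq = inj₂ eq

    ∋-∧⁺ : ∀ {e e′} → P ∋ e → P ∋ e′ → P ∋ e ∧ e′
    ∋-∧⁺ {e} {e′} i i′ = trans (∧-homo P e e′) (cong₂ Bool._∧_ i i′)

    ∋-∧⁻ : ∀ {e e′} → P ∋ e ∧ e′ → P ∋ e × P ∋ e′
    ∋-∧⁻ {e} {e′} i = ∧-elim (trans (sym (∧-homo P e e′)) i)

    ∋-∨⁻ : ∀ {e e′} → P ∋ e ∨ e′ → P ∋ e ⊎ P ∋ e′
    ∋-∨⁻ {e} {e′} i = ∨-elim (trans (sym (∨-homo P e e′)) i)

    ∋-upward : ∀ {e e′} → e ≤ e′ → P ∋ e → P ∋ e′
    ∋-upward {e} {e′} e≤e′ i = proj₂ (∋-∧⁻ (trans (≈-cong P e∧e′≈e) i))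
      where
      e∧e′≈e : e ∧ e′ ≈ e
      e∧e′≈e = antisym (x∧y≤x e e′) (∧-greatest ≤-refl e≤e′)

    ∌-downward : ∀ {e e′} → e ≤ e′ → P ∌ e′ → P ∌ e
    ∌-downward e≤e′ o = ¬true⇒false λ i → true≢false (∋-upward e≤e′ i) o

    ∋-∨⁺ˡ : ∀ {e e′} → P ∋ e → P ∋ e ∨ e′
    ∋-∨⁺ˡ = ∋-upward (x≤x∨y _ _)

    ∋-∨⁺ʳ : ∀ {e e′} → P ∋ e′ → P ∋ e ∨ e′
    ∋-∨⁺ʳ = ∋-upward (y≤x∨y _ _)

  ⋀ ⋁ : (ℕ → Carrier) → ℕ → Carrier
  ⋀ g zero    = ⊤
  ⋀ g (suc N) = ⋀ g N ∧ g N
  ⋁ g zero    = ⊥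
  ⋁ g (suc N) = ⋁ g N ∨ g N

  module _ (P : PrimeFilter) (g : ℕ → Carrier) where

    ∋-⋀⁺ : ∀ N → (∀ n → n < N → P ∋ g n) → P ∋ ⋀ g N
    ∋-⋀⁺ zero    _  = ⊤-homo P
    ∋-⋀⁺ (suc N) ∋g = ∋-∧⁺ P (∋-⋀⁺ N λ n n<N → ∋g n (ℕ.m<n⇒m<1+n n<N)) (∋g N (ℕ.n<1+n N))

    ∋-⋀⁻ : ∀ N → P ∋ ⋀ g N → ∀ {n} → n < N → P ∋ g n
    ∋-⋀⁻ (suc N) i n<1+N with ℕ.m<1+n⇒m<n∨m≡n n<1+N
    ... | inj₁ n<N  = ∋-⋀⁻ N (proj₁ (∋-∧⁻ P i)) n<N
    ... | inj₂ refl = proj₂ (∋-∧⁻ P i)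

    ∋-⋁⁺ : ∀ N {n} → n < N → P ∋ g n → P ∋ ⋁ g N
    ∋-⋁⁺ (suc N) n<1+N i with ℕ.m<1+n⇒m<n∨m≡n n<1+N
    ... | inj₁ n<N  = ∋-∨⁺ˡ P (∋-⋁⁺ N n<N i)
    ... | inj₂ refl = ∋-∨⁺ʳ P i

    ∋-⋁⁻ : ∀ N → P ∋ ⋁ g N → ∃ λ n → n < N × P ∋ g n
    ∋-⋁⁻ zero    i = ⊥-elim (true≢false i (⊥-homo P))
    ∋-⋁⁻ (suc N) i with ∋-∨⁻ P i
    ... | inj₁ j = let n , n<N , k = ∋-⋁⁻ N j in n , ℕ.m<n⇒m<1+n n<N , k
    ... | inj₂ j = N , ℕ.n<1+n N , j

  module _ (a b : Carrier) where
    private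
      I : Pred Carrier ℓ₂
      I = Ideal L a b

    ideal-downward : ∀ {d e} → d ≤ e → I e → I d
    ideal-downward d≤e = ≤-trans (∧-monotonic d≤e ≤-refl)

    -- Two cuts on `(d ∨ e) ∧ a`: removing `d` places it below `b ∨ e`, removing `e` places it below
    -- `b`.
    ideal-∨ : ∀ {d e} → I d → I e → I (d ∨ e)
    ideal-∨ {d} {e} i j = cut {s = b} {g = e}
      (cut {g = d} (≤-trans (x∧y≤x _ _) (∨-least (y≤x∨y _ _) (≤-trans (y≤x∨y _ _) (x≤x∨y _ _))))
        (≤-trans (∧-greatest (x∧y≤y _ _) (≤-trans (x∧y≤x _ _) (x∧y≤y _ _))) (≤-trans i (x≤x∨y _ _))))
      (≤-trans (∧-greatest (x∧y≤y _ _) (≤-trans (x∧y≤x _ _) (x∧y≤y _ _))) j)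

    ideal-⊥ : I ⊥
    ideal-⊥ = ≤-trans (x∧y≤x ⊥ a) (minimum b)

    ideal-⋁ : ∀ {g} N → (∀ n → I (g n)) → I (⋁ g N)
    ideal-⋁ zero    i = ideal-⊥
    ideal-⋁ (suc N) i = ideal-∨ (ideal-⋁ N i) (i N)

  -- Stating `disjoint` with `≤` yields both the disjointness of filter and ideal and the
  -- monotonicity of `χ`.
  module FromComplement {i o} (In : Pred Carrier i) (Out : Pred Carrier o)
    (split     : ∀ e → In e ⊎ Out e)
    (disjoint  : ∀ {e e′} → In e → Out e′ → ¬ e ≤ e′)
    (In-∧      : ∀ {e e′} → In e → In e′ → In (e ∧ e′))
    (Out-∨     : ∀ {e e′} → Out e → Out e′ → Out (e ∨ e′))
    (In-⊤ : In ⊤) (Out-⊥ : Out ⊥) where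

    χ : Carrier → Bool
    χ e = [ (λ _ → true) , (λ _ → false) ]′ (split e)

    In⇒true : ∀ {e} → In e → χ e ≡ true
    In⇒true {e} i with split e
    ... | inj₁ _ = refl
    ... | inj₂ o = ⊥-elim (disjoint i o ≤-refl)

    Out⇒false : ∀ {e} → Out e → χ e ≡ false
    Out⇒false {e} o with split e
    ... | inj₁ i = ⊥-elim (disjoint i o ≤-refl)
    ... | inj₂ _ = refl

    true⇒In : ∀ {e} → χ e ≡ true → In e
    true⇒In {e} eq with split e
    ... | inj₁ i = i

    false⇒Out : ∀ {e} → χ e ≡ false → Out e
    false⇒Out {e} eq with split e
    ... | inj₂ o = o

    χ-mono : ∀ {e e′} → e ≤ e′ → χ e ≡ true → χ e′ ≡ true
    χ-mono {e′ = e′} e≤e′ eq with split e′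
    ... | inj₁ _ = refl
    ... | inj₂ o = ⊥-elim (disjoint (true⇒In eq) o e≤e′)

    χ-∧ : ∀ e e′ → χ (e ∧ e′) ≡ χ e Bool.∧ χ e′
    χ-∧ e e′ with χ e in eq | χ e′ in eq′
    ... | true  | true  = In⇒true (In-∧ (true⇒In eq) (true⇒In eq′))
    ... | true  | false = ¬true⇒false λ t → true≢false (χ-mono (x∧y≤y e e′) t) eq′
    ... | false | _     = ¬true⇒false λ t → true≢false (χ-mono (x∧y≤x e e′) t) eq

    χ-∨ : ∀ e e′ → χ (e ∨ e′) ≡ χ e Bool.∨ χ e′
    χ-∨ e e′ with χ e in eq | χ e′ in eq′
    ... | false | false = Out⇒false (Out-∨ (false⇒Out eq) (false⇒Out eq′))
    ... | false | true  = χ-mono (y≤x∨y e e′) eq′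
    ... | true  | _     = χ-mono (x≤x∨y e e′) eq

    primeFilter : PrimeFilter
    primeFilter = record
      { char   = χ
      ; ≈-cong = λ e≈e′ → bool-ext (χ-mono (≤-reflexive e≈e′)) (χ-mono (≤-reflexive (Eq.sym e≈e′)))
      ; ∧-homo = χ-∧
      ; ∨-homo = χ-∨
      ; ⊤-homo = In⇒true In-⊤
      ; ⊥-homo = Out⇒false Out-⊥
      }

-- Countable lattices: prime filters from an enumeration.

module CountableLattice (em : ∀ {ℓ} → ExcludedMiddle ℓ) {c ℓ₁ ℓ₂}
  (L : BoundedDistributiveLattice c ℓ₁ ℓ₂) (countable : Countable L) where
  open BoundedDistributiveLattice L
    renaming (refl to ≤-refl; trans to ≤-trans; reflexive to ≤-reflexive)
  open import Relation.Binary.Lattice.Properties.MeetSemilattice meetSemilattice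
    using (∧-monotonic)
  open import Relation.Binary.Lattice.Properties.JoinSemilattice joinSemilattice
    using (∨-monotonic)
  open Classical em
  open Lattice L

  enum : ℕ → Carrier
  enum n with em {P = ∃ λ e → Injection.to countable e ≡ n}
  ... | yes (e , _) = e
  -- Numbers outside the range of the injection default to `⊥`, which only adds repetitions to the
  -- enumeration.
  ... | no  _       = ⊥

  enum-surjective : ∀ e → ∃ λ n → enum n ≈ e
  enum-surjective e = Injection.to countable e , enum-to
    where
    enum-to : enum (Injection.to countable e) ≈ e
    enum-to with em {P = ∃ λ e′ → Injection.to countable e′ ≡ Injection.to countable e}
    ... | yes (e′ , eq) = Injection.injective countable eq
    ... | no  ¬∃        = ⊥-elim (¬∃ (e , refl))

  -- With D = {⊤} this is the prime filter theorem. In general it yields a prime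
  -- filter every basic neighbourhood u n ∖ v n of which meets ⋃ D.
  module Separation {f k d} (F : Pred Carrier f) (K : Pred Carrier k) (D : Pred Carrier d)
    (F-⊤ : F ⊤) (F-∧ : ∀ {e e′} → F e → F e′ → F (e ∧ e′))
    (K-⊥ : K ⊥) (K-∨ : ∀ {e e′} → K e → K e′ → K (e ∨ e′))
    (separated : ∀ {e k} → F e → K k → ∃ λ d → D d × ¬ (d ∧ e ≤ k)) where

    -- Consistency of the decisions made so far, `u` being the meet of the accepted and `v` the join
    -- of the rejected elements.
    Good : Carrier → Carrier → Set _
    Good u v = ∀ {e k} → F e → K k → ∃ λ d → D d × ¬ (d ∧ (e ∧ u) ≤ k ∨ v)

    good-start : Good ⊤ ⊥
    good-start fe kk =
      let d , Dd , ≰ = separated fe kk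
      in  d , Dd , λ le → ≰ (≤-trans (∧-monotonic ≤-refl (∧-greatest ≤-refl (maximum _)))
                            (≤-trans le (∨-least ≤-refl (minimum _))))

    -- If rejecting `g` fails at `e` and `k`, then accepting it succeeds: for given `e′` and `k′`,
    -- take the `d` that `good` supplies at `e ∧ e′` and `k ∨ k′`. Were it no witness, cutting `g`
    -- would contradict its choice.
    good-step : ∀ {u v} g → Good u v → ¬ Good (u ∧ g) v → Good u (v ∨ g)
    good-step {u} {v} g good ¬good {e} {k} fe kk = by-contradiction λ ¬∃ →
      ¬good λ {e′} {k′} fe′ kk′ →
        let d , Dd , ≰ = good (F-∧ fe fe′) (K-∨ kk kk′)
            le : d ∧ (e ∧ u) ≤ k ∨ (v ∨ g)
            le = by-contradiction λ ≰′ → ¬∃ (d , Dd , ≰′)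
        in  d , Dd , λ le′ → ≰ (cut {g = g}
              (≤-trans (∧-monotonic ≤-refl (∧-monotonic (x∧y≤x e e′) ≤-refl))
                (≤-trans le (∨-least (≤-trans (x≤x∨y k k′) (≤-trans (x≤x∨y _ v) (x≤x∨y _ g)))
                                     (∨-monotonic (y≤x∨y (k ∨ k′) v) ≤-refl))))
              (≤-trans (∧-greatest (≤-trans (x∧y≤x _ g) (x∧y≤x d _))
                          (∧-greatest (≤-trans (x∧y≤x _ g)
                              (≤-trans (x∧y≤y d _) (≤-trans (x∧y≤x _ u) (x∧y≤y e e′))))
                            (∧-greatest (≤-trans (x∧y≤x _ g) (≤-trans (x∧y≤y d _) (x∧y≤y _ u)))
                                        (x∧y≤y _ g))))
                (≤-trans le′ (∨-monotonic (y≤x∨y k k′) ≤-refl))))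

    State : Set _
    State = Σ (Carrier × Carrier) λ (u , v) → Good u v

    next : Carrier → State → State
    next g ((u , v) , good) with em {P = Good (u ∧ g) v}
    ... | yes good′ = (u ∧ g , v) , good′
    ... | no ¬good′ = (u , v ∨ g) , good-step g good ¬good′

    lower upper : State → Carrier
    lower ((u , _) , _) = u
    upper ((_ , v) , _) = v

    _◁_ : Rel State ℓ₂
    s ◁ t = lower t ≤ lower s × upper s ≤ upper t

    ◁-next : ∀ g s → s ◁ next g s
    ◁-next g ((u , v) , good) with em {P = Good (u ∧ g) v}
    ... | yes _ = x∧y≤x u g , ≤-refl
    ... | no  _ = ≤-refl , x≤x∨y v g

    next-decides : ∀ g s → lower (next g s) ≤ g ⊎ g ≤ upper (next g s)
    next-decides g ((u , v) , good) with em {P = Good (u ∧ g) v}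
    ... | yes _ = inj₁ (x∧y≤y u g)
    ... | no  _ = inj₂ (y≤x∨y v g)

    σ : ℕ → State
    σ zero    = (⊤ , ⊥) , good-start
    σ (suc n) = next (enum n) (σ n)

    u v : ℕ → Carrier
    u = lower ∘ σ
    v = upper ∘ σ

    good : ∀ n → Good (u n) (v n)
    good n = proj₂ (σ n)

    ◁-σ : ∀ {m n} → m ℕ.≤ n → σ m ◁ σ n
    ◁-σ {m} m≤n with ℕ.m≤n⇒m<n∨m≡n m≤n
    ... | inj₁ m<n  = successive⇒all {_◁_ = _◁_}
                        (λ (p , q) (p′ , q′) → ≤-trans p′ p , ≤-trans q q′)
                        σ (λ n → ◁-next (enum n) (σ n)) m<n
    ... | inj₂ refl = ≤-refl , ≤-refl

    -- The filter generated by the `u n` and the ideal generated by the `v n`. They exhaust `L`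
    -- since every element is decided at some stage, and `Good` keeps them apart.
    In Out : Pred Carrier ℓ₂
    In  e = ∃ λ n → u n ≤ e
    Out e = ∃ λ n → e ≤ v n

    split : ∀ e → In e ⊎ Out e
    split e =
      let n , eq = enum-surjective e
      -- The element numbered `n` is decided in passing to stage `suc n`.
      in  Sum.map (λ le → suc n , ≤-trans le (≤-reflexive eq))
                  (λ le → suc n , ≤-trans (≤-reflexive (Eq.sym eq)) le)
                  (next-decides (enum n) (σ n))

    disjoint : ∀ {e e′} → In e → Out e′ → ¬ e ≤ e′
    disjoint (m , p) (n , q) e≤e′ =
      let _ , _ , ≰ = good (m ⊔ n) F-⊤ K-⊥
      in  ≰ (≤-trans (x∧y≤y _ _) (≤-trans (x∧y≤y _ _)
            (≤-trans (proj₁ (◁-σ (ℕ.m≤m⊔n m n))) (≤-trans p (≤-trans e≤e′ (≤-trans q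
            (≤-trans (proj₂ (◁-σ (ℕ.m≤n⊔m m n))) (y≤x∨y _ _))))))))

    In-∧ : ∀ {e e′} → In e → In e′ → In (e ∧ e′)
    In-∧ (m , p) (n , q) = m ⊔ n ,
      ∧-greatest (≤-trans (proj₁ (◁-σ (ℕ.m≤m⊔n m n))) p) (≤-trans (proj₁ (◁-σ (ℕ.m≤n⊔m m n))) q)

    Out-∨ : ∀ {e e′} → Out e → Out e′ → Out (e ∨ e′)
    Out-∨ (m , p) (n , q) = m ⊔ n ,
      ∨-least (≤-trans p (proj₂ (◁-σ (ℕ.m≤m⊔n m n)))) (≤-trans q (proj₂ (◁-σ (ℕ.m≤n⊔m m n))))

    open FromComplement In Out split disjoint In-∧ Out-∨ (0 , ≤-refl) (0 , ≤-refl) public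
      using (primeFilter; true⇒In; false⇒Out)

    eventually-below : ∀ {e} → primeFilter ∋ e → ∃ λ N → ∀ {n} → N ℕ.≤ n → u n ≤ e
    eventually-below e∈ = let N , le = true⇒In e∈ in N , λ N≤n → ≤-trans (proj₁ (◁-σ N≤n)) le

    eventually-above : ∀ {e} → primeFilter ∌ e → ∃ λ N → ∀ {n} → N ℕ.≤ n → e ≤ v n
    eventually-above e∉ = let N , le = false⇒Out e∉ in N , λ N≤n → ≤-trans le (proj₂ (◁-σ N≤n))

    -- Since `Good` quantifies over all of `F`, an `e` in `F` that ended up below some `v n` would
    -- refute `good n`.
    F⊆ : ∀ {e} → F e → primeFilter ∋ e
    F⊆ fe = by-contradiction λ e∌ →
      let n , e≤v = false⇒Out (¬true⇒false e∌)
          _ , _ , ≰ = good n fe K-⊥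
      in  ≰ (≤-trans (x∧y≤y _ _) (≤-trans (x∧y≤x _ _) (≤-trans e≤v (y≤x∨y _ _))))

    K∌ : ∀ {e} → K e → primeFilter ∌ e
    K∌ ke = ¬true⇒false λ e∈ →
      let n , u≤e = true⇒In e∈
          _ , _ , ≰ = good n F-⊤ ke
      in  ≰ (≤-trans (x∧y≤y _ _) (≤-trans (x∧y≤y _ _) (≤-trans u≤e (x≤x∨y _ _))))

  prime-above : ∀ {p q} → ¬ p ≤ q → ∃ λ P → P ∋ p × P ∌ q
  prime-above {p} {q} p≰q = primeFilter , F⊆ ≤-refl , K∌ ≤-refl
    where
    open Separation (p ≤_) (_≤ q) (_≡ ⊤) (maximum p) ∧-greatest (minimum q) ∨-least
      (λ p≤e k≤q → ⊤ , refl , λ le →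
        p≰q (≤-trans (∧-greatest (maximum p) p≤e) (≤-trans le k≤q)))

  -- The filter generated by `P` and `a` avoids the ideal below `b` exactly because `P` misses
  -- `I_{a→b}`; a prime filter separating the two is the extension.
  prime-extension : ∀ (P : PrimeFilter) {a b} → (∀ {e} → e ∧ a ≤ b → P ∌ e) →
                    ∃ λ Q → P ⊆ Q × Q ∋ a × Q ∌ b
  prime-extension P {a} {b} P∌I =
    primeFilter , (λ e∈ → F⊆ (_ , e∈ , x∧y≤x _ a)) , F⊆ (⊤ , ⊤-homo P , x∧y≤y ⊤ a) , K∌ ≤-refl
    where
    F : Pred Carrier (c ⊔ˡ ℓ₂)
    F e = ∃ λ e₀ → P ∋ e₀ × e₀ ∧ a ≤ e

    F-∧ : ∀ {e e′} → F e → F e′ → F (e ∧ e′)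
    F-∧ (e₀ , i , le) (e₀′ , i′ , le′) = e₀ ∧ e₀′ , ∋-∧⁺ P i i′ ,
      ∧-greatest (≤-trans (∧-monotonic (x∧y≤x _ _) ≤-refl) le)
                 (≤-trans (∧-monotonic (x∧y≤y _ _) ≤-refl) le′)

    separated : ∀ {e k} → F e → k ≤ b → ∃ λ d → d ≡ ⊤ × ¬ (d ∧ e ≤ k)
    separated (e₀ , i , le) k≤b = ⊤ , refl , λ le′ → true≢false i
      (P∌I (≤-trans le (≤-trans (∧-greatest (maximum _) ≤-refl) (≤-trans le′ k≤b))))

    open Separation F (_≤ b) (_≡ ⊤) (⊤ , ⊤-homo P , maximum _) F-∧ (minimum b) ∨-least separated

  -- The points x < y and z n → x of the dual space: every z n lies in the open
  -- set ⋃ I_{a→b}, witnessed by d n, and x does not since y ⊇ x contains a but not b.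
  record Configuration : Set (c ⊔ˡ ℓ₁ ⊔ˡ ℓ₂) where
    field
      a b : Carrier
      x y : PrimeFilter
      z   : ℕ → PrimeFilter
      d   : ℕ → Carrier
      x⊆y : x ⊆ y
      y∋a : y ∋ a
      y∌b : y ∌ b
      z∌a : ∀ n → z n ∌ a
      d∈I : ∀ n → Ideal L a b (d n)
      z∋d : ∀ n → z n ∋ d n
      z∌d : ∀ {m n} → m < n → z n ∌ d m
      z→x : ∀ e → ∃ λ N → ∀ {n} → N ℕ.≤ n → char (z n) e ≡ char x e

  subsequence : ∀ {f} → Increasing f → Configuration → Configuration
  subsequence {f} f-inc C = record
    { Configuration C
    ; z   = C.z ∘ f
    ; d   = C.d ∘ f
    ; z∌a = C.z∌a ∘ f
    ; d∈I = C.d∈I ∘ f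
    ; z∋d = C.z∋d ∘ f
    ; z∌d = C.z∌d ∘ f-inc
    ; z→x = λ e → let N , lim = C.z→x e in
              N , λ N≤n → lim (ℕ.≤-trans N≤n (increasing⇒≥id f-inc _))
    }
    where module C = Configuration C

  -- From an ideal without greatest element to a configuration.

  record LimitPoint (a b : Carrier) : Set (c ⊔ˡ ℓ₁ ⊔ˡ ℓ₂) where
    field
      x    : PrimeFilter
      u v  : ℕ → Carrier
      x∌I  : ∀ {e} → Ideal L a b e → x ∌ e
      eventually-below : ∀ {e} → x ∋ e → ∃ λ N → ∀ {n} → N ℕ.≤ n → u n ≤ e
      eventually-above : ∀ {e} → x ∌ e → ∃ λ N → ∀ {n} → N ℕ.≤ n → e ≤ v n
      -- However close to `x`, no single member of `I` exhausts the open set `⋃ I`, so new members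
      -- can always be found there.
      meets-I : ∀ n {k} → Ideal L a b k → ∃ λ d → Ideal L a b d × ¬ (d ∧ u n ≤ k ∨ v n)

  -- `Separation` is used with `K` and `D` both equal to `I`: as `K` it makes `x` miss `I`, as `D`
  -- it makes every neighbourhood of `x` meet `⋃ I`. The hypothesis `separated` is the absence of a
  -- greatest element.
  limitPoint : ∀ {a b} → ¬ Greatest L (Ideal L a b) → LimitPoint a b
  limitPoint {a} {b} ¬principal = record
    { x = primeFilter ; u = u ; v = v ; x∌I = K∌
    ; eventually-below = eventually-below ; eventually-above = eventually-above
    ; meets-I = λ n ik → let d , id , ≰ = good n ≤-refl ik in
        d , id , λ le → ≰ (≤-trans (∧-monotonic ≤-refl (x∧y≤y ⊤ (u n))) le)
    }
    where
    I : Pred Carrier ℓ₂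
    I = Ideal L a b

    escape : ∀ {k} → I k → ∃ λ d → I d × ¬ d ≤ k
    escape {k} ik =
      let d , ¬f = ¬∀⇒∃¬ λ (f : ∀ e → I e → e ≤ k) → ¬principal (k , ik , f _)
      in  d , ¬⇒× ¬f

    separated : ∀ {e k} → ⊤ ≤ e → I k → ∃ λ d → I d × ¬ (d ∧ e ≤ k)
    separated ⊤≤e ik = let d , id , ≰ = escape ik in
      d , id , λ le → ≰ (≤-trans (∧-greatest ≤-refl (≤-trans (maximum d) ⊤≤e)) le)

    open Separation (⊤ ≤_) I I ≤-refl ∧-greatest (ideal-⊥ a b) (ideal-∨ a b) separated

  module FromLimitPoint {a b : Carrier} (limit : LimitPoint a b) where
    open LimitPoint limit

    I : Pred Carrier ℓ₂
    I = Ideal L a b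

    extension : ∃ λ Q → x ⊆ Q × Q ∋ a × Q ∌ b
    extension = prime-extension x x∌I

    -- A simultaneous recursion: `k n` is the join of `b` and all earlier `d m`, and `d n` is not
    -- below it near `x`. A point `z n` witnessing this contains `d n` and misses every earlier
    -- `d m`.
    ideal : ℕ → Σ Carrier I
    fresh : ∀ n → ∃ λ d → I d × ¬ (d ∧ u n ≤ proj₁ (ideal n) ∨ v n)

    fresh n = meets-I n (proj₂ (ideal n))
    -- Starting from `b` rather than `⊥` makes every `z n` miss `b`, and hence `a`, because
    -- `d n ∧ a ≤ b`.
    ideal zero    = b , x∧y≤x b a
    ideal (suc n) = let k , ik = ideal n ; d , id , _ = fresh n in k ∨ d , ideal-∨ a b ik id

    k d : ℕ → Carrier
    k = proj₁ ∘ ideal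
    d = proj₁ ∘ fresh

    k-mono : ∀ {m n} → m < n → k m ∨ d m ≤ k n
    k-mono m<n = go (ℕ.≤⇒≤′ m<n)
      where
      go : ∀ {m n} → suc m ℕ.≤′ n → k m ∨ d m ≤ k n
      go ℕ.≤′-refl      = ≤-refl
      go (ℕ.≤′-step lt) = ≤-trans (go lt) (x≤x∨y _ _)

    b≤k : ∀ n → b ≤ k n
    b≤k zero    = ≤-refl
    b≤k (suc n) = ≤-trans (b≤k n) (x≤x∨y _ _)

    point : ∀ n → ∃ λ P → P ∋ d n ∧ u n × P ∌ k n ∨ v n
    point n = prime-above (proj₂ (proj₂ (fresh n)))

    z : ℕ → PrimeFilter
    z = proj₁ ∘ point

    z∋d : ∀ n → z n ∋ d n
    z∋d n = ∋-upward (z n) (x∧y≤x _ _) (proj₁ (proj₂ (point n)))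

    z∋u : ∀ n → z n ∋ u n
    z∋u n = ∋-upward (z n) (x∧y≤y _ _) (proj₁ (proj₂ (point n)))

    z∌k : ∀ n → z n ∌ k n
    z∌k n = ∌-downward (z n) (x≤x∨y _ _) (proj₂ (proj₂ (point n)))

    z∌v : ∀ n → z n ∌ v n
    z∌v n = ∌-downward (z n) (y≤x∨y _ _) (proj₂ (proj₂ (point n)))

    z→x : ∀ e → ∃ λ N → ∀ {n} → N ℕ.≤ n → char (z n) e ≡ char x e
    z→x e with char x e in eq
    ... | true  = let N , below = eventually-below eq in
                  N , λ {n} N≤n → ∋-upward (z n) (below N≤n) (z∋u n)
    ... | false = let N , above = eventually-above eq in
                  N , λ {n} N≤n → ∌-downward (z n) (above N≤n) (z∌v n)

    configuration : Configuration
    configuration = record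
      { a = a ; b = b ; x = x ; y = proj₁ extension ; z = z ; d = d
      ; x⊆y = proj₁ (proj₂ extension)
      ; y∋a = proj₁ (proj₂ (proj₂ extension))
      ; y∌b = proj₂ (proj₂ (proj₂ extension))
      ; z∌a = λ n → ¬true⇒false λ i → true≢false
                (∋-upward (z n) (proj₁ (proj₂ (fresh n))) (∋-∧⁺ (z n) (z∋d n) i))
                (∌-downward (z n) (b≤k n) (z∌k n))
      ; d∈I = λ n → proj₁ (proj₂ (fresh n))
      ; z∋d = z∋d
      ; z∌d = λ {m} {n} m<n →
                ∌-downward (z n) (≤-trans (y≤x∨y (k m) (d m)) (k-mono m<n)) (z∌k n)
      ; z→x = z→x
      }

  -- Realising prescribed traces on the points of a configuration.

  module Realisation (C : Configuration) where
    open Configuration C public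

    I : Pred Carrier ℓ₂
    I = Ideal L a b

    y∌I : ∀ {e} → I e → y ∌ e
    y∌I e∈I = ¬true⇒false λ i → true≢false (∋-upward y e∈I (∋-∧⁺ y i y∋a)) y∌b

    x∌ : ∀ {e} → y ∌ e → x ∌ e
    x∌ o = ¬true⇒false λ i → true≢false (x⊆y i) o

    ⊈⇒∃ : ∀ P Q → ¬ P ⊆ Q → ∃ λ e → P ∋ e × Q ∌ e
    ⊈⇒∃ P Q P⊈Q =
      let e , ¬f = ¬∀⇒∃¬ (λ f → P⊈Q λ {e} → f e)
          i , ¬j = ¬⇒× ¬f
      in  e , i , ¬true⇒false ¬j

    -- `d n` already excludes all later points. Each of the finitely many earlier ones not above
    -- `z n` is excluded by one further element of `z n`.
    principal-upset : ∀ n → ∃ λ s → I s × z n ∋ s × ∀ {k} → z k ∋ s → z n ⊆ z k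
    principal-upset n = d n ∧ ⋀ g n , ideal-downward a b (x∧y≤x _ _) (d∈I n) ,
      ∋-∧⁺ (z n) (z∋d n) (∋-⋀⁺ (z n) g n λ k _ → proj₁ (proj₂ (witness k))) , above
      where
      witness : ∀ k → ∃ λ e → z n ∋ e × (z k ∋ e → z n ⊆ z k)
      witness k with em {P = z n ⊆ z k}
      -- No exclusion is called for here, and `⊤` leaves the meet unchanged.
      ... | yes zn⊆zk = ⊤ , ⊤-homo (z n) , λ _ → zn⊆zk
      ... | no  zn⊈zk = let e , i , o = ⊈⇒∃ (z n) (z k) zn⊈zk in e , i , λ i′ → ⊥-elim (true≢false i′ o)

      g : ℕ → Carrier
      g = proj₁ ∘ witness

      above : ∀ {k} → z k ∋ d n ∧ ⋀ g n → z n ⊆ z k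
      above {k} i with ℕ.<-cmp k n | ∋-∧⁻ (z k) i
      ... | tri< k<n _ _  | _ , j = proj₂ (proj₂ (witness k)) (∋-⋀⁻ (z k) g n j k<n)
      ... | tri≈ _ refl _ | _     = id
      ... | tri> _ _ n<k  | j , _ = ⊥-elim (true≢false j (z∌d n<k))

    module _ (V : ℕ → Bool) {N} (bounded : ∀ n → V n ≡ true → n < N)
      (upset : ∀ {m n} → z m ⊆ z n → V m ≡ true → V n ≡ true) where

      -- A finite upset is the union of the principal upsets of its members; indices outside `V`
      -- contribute `⊥`.
      finite-upset : ∃ λ e → I e × ∀ n → char (z n) e ≡ V n
      finite-upset = ⋁ (proj₁ ∘ s) N , ideal-⋁ a b N (proj₁ ∘ proj₂ ∘ s) , λ k →
        bool-ext
          (λ i → let n , _ , j = ∋-⋁⁻ (z k) (proj₁ ∘ s) N i in proj₁ (proj₂ (proj₂ (s n))) j)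
          (λ v → ∋-⋁⁺ (z k) (proj₁ ∘ s) N (bounded k v) (proj₂ (proj₂ (proj₂ (s k))) v))
        where
        s : ∀ n → ∃ λ s → I s × (∀ {k} → z k ∋ s → V k ≡ true) × (V n ≡ true → z n ∋ s)
        s n with V n in eq
        ... | true  = let s , s∈I , i , above = principal-upset n in
                      s , s∈I , (λ j → upset (above j) eq) , λ _ → i
        ... | false = ⊥ , ideal-⊥ a b , (λ i → ⊥-elim (true≢false i (⊥-homo (z _)))) , λ ()

      -- Members of `I` miss `y`. To reach `y`, join with `a`, which lies in `y` but in no `z n`, so
      -- the trace on the `z n` is unchanged.
      realise : ∀ v → ∃ λ e → (∀ n → char (z n) e ≡ V n) × char y e ≡ v × x ∌ e × (v ≡ false → I e)
      realise false = let e , e∈I , eq = finite-upset in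
        e , eq , y∌I e∈I , x∌ (y∌I e∈I) , λ _ → e∈I
      realise true  = let e , e∈I , eq = finite-upset in
        e ∨ a ,
        (λ n → trans (∨-homo (z n) e a) (trans (cong₂ Bool._∨_ (eq n) (z∌a n))
                                           (Bool.∨-identityʳ (V n)))) ,
        ∋-∨⁺ʳ y y∋a ,
        trans (∨-homo x e a) (cong₂ Bool._∨_ (x∌ (y∌I e∈I)) x∌a) ,
        λ ()
        where
        x∌a : x ∌ a
        -- The limit `x` inherits the absence of `a` from the `z n`.
        x∌a = let N , lim = z→x a in trans (sym (lim ℕ.≤-refl)) (z∌a N)

    Antichain : Set c
    Antichain = ∀ {m n} → z m ⊆ z n → m ≡ n

    -- An earlier `z m` is never contained in a later `z n`, as `d m` separates them; only the other
    -- direction has to be excluded.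
    antichain : (∀ {m n} → m < n → ¬ z n ⊆ z m) → Antichain
    antichain ⊈ {m} {n} zm⊆zn with ℕ.<-cmp m n
    ... | tri< m<n _ _ = ⊥-elim (true≢false (zm⊆zn (z∋d m)) (z∌d m<n))
    ... | tri≈ _ eq _  = eq
    ... | tri> _ _ n<m = ⊥-elim (⊈ n<m zm⊆zn)

    -- An element `t` of `x` can be chosen to avoid the finitely many points outside `V`. By
    -- convergence it holds at all but finitely many `z n`, and a finite set, an upset in an
    -- antichain, supplies the rest.
    realise-cofinite : Antichain → (∀ n → ¬ x ⊆ z n) →
      (V : ℕ → Bool) (N : ℕ) → (∀ {n} → N ℕ.≤ n → V n ≡ true) →
      ∃ λ e → (∀ n → char (z n) e ≡ V n) × y ∋ e
    realise-cofinite anti x⊈z V N V-true = t ∨ e , eq , ∋-∨⁺ˡ y (x⊆y x∋t)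
      where
      g : ∀ n → ∃ λ g → x ∋ g × (z n ∋ g → V n ≡ true)
      g n with V n
      ... | true  = ⊤ , ⊤-homo x , λ _ → refl
      ... | false = let e , i , o = ⊈⇒∃ x (z n) (x⊈z n) in e , i , λ i′ → ⊥-elim (true≢false i′ o)

      t : Carrier
      t = ⋀ (proj₁ ∘ g) N

      x∋t : x ∋ t
      x∋t = ∋-⋀⁺ x (proj₁ ∘ g) N λ n _ → proj₁ (proj₂ (g n))

      M : ℕ
      M = proj₁ (z→x t)

      z∋t : ∀ {n} → M ℕ.≤ n → z n ∋ t
      z∋t M≤n = trans (proj₂ (z→x t) M≤n) x∋t

      -- The members of `V` below `M`, which `t` may have missed.
      W : ℕ → Bool
      W n = V n Bool.∧ (n ℕ.<ᵇ M)

      W⁻ : ∀ n → W n ≡ true → V n ≡ true × n < M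
      W⁻ n w with V n | n ℕ.<ᵇ M in eq
      ... | true | true = refl , ℕ.<ᵇ⇒< n M (subst T (sym eq) _)

      W⁺ : ∀ {n} → V n ≡ true → n < M → W n ≡ true
      W⁺ v n<M = cong₂ Bool._∧_ v (Equivalence.to Bool.T-≡ (ℕ.<⇒<ᵇ n<M))

      realised : ∃ λ e → I e × ∀ n → char (z n) e ≡ W n
      realised = finite-upset W (λ n w → proj₂ (W⁻ n w))
                   (λ le w → subst (λ k → W k ≡ true) (anti le) w)

      e : Carrier
      e = proj₁ realised

      eq : ∀ n → char (z n) (t ∨ e) ≡ V n
      eq n = bool-ext to from
        where
        to : z n ∋ t ∨ e → V n ≡ true
        to i with ∋-∨⁻ (z n) i | n ℕ.<? N
        ... | inj₁ j | yes n<N = proj₂ (proj₂ (g n)) (∋-⋀⁻ (z n) (proj₁ ∘ g) N j n<N)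
        ... | inj₁ _ | no  n≮N = V-true (ℕ.≮⇒≥ n≮N)
        ... | inj₂ j | _       = proj₁ (W⁻ n (trans (sym (proj₂ (proj₂ realised) n)) j))

        from : V n ≡ true → z n ∋ t ∨ e
        from v with n ℕ.<? M
        ... | yes n<M = ∋-∨⁺ʳ (z n) (trans (proj₂ (proj₂ realised) n) (W⁺ v n<M))
        ... | no  n≮M = ∋-∨⁺ˡ (z n) (z∋t (ℕ.≮⇒≥ n≮M))

    -- The homomorphisms onto the three lattices.

    ReducesTo : (M : BoundedDistributiveLattice 0ℓ 0ℓ 0ℓ) → BoundedDistributiveLattice.Carrier M →
                Set (c ⊔ˡ ℓ₁ ⊔ˡ ℓ₂)
    ReducesTo M c₀ = ∃ λ h → IsOntoBoundedLatticeHomomorphism L M h ×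
      (∃₂ λ a b → image L M h (Ideal L a b) ≐ Ideal M c₀ (BoundedDistributiveLattice.⊥ M))

    -- The graph of the homomorphism dual to the inclusion of the points x, y, z n.
    record Representation (M : BoundedDistributiveLattice 0ℓ 0ℓ 0ℓ)
      (c₀ : BoundedDistributiveLattice.Carrier M) : Set (lsuc 0ℓ ⊔ˡ c ⊔ˡ ℓ₁ ⊔ˡ ℓ₂) where
      private module M = BoundedDistributiveLattice M
      field
        _⊩_    : Carrier → M.Carrier → Set
        total  : ∀ e → ∃ λ m → e ⊩ m
        onto   : ∀ m → ∃ λ e → e ⊩ m × (m M.∧ c₀ M.≤ M.⊥ → I e)
        unique : ∀ {e e′ m m′} → e ≈ e′ → e ⊩ m → e′ ⊩ m′ → m M.≈ m′
        ⊩-∧    : ∀ {e e′ m m′} → e ⊩ m → e′ ⊩ m′ → (e ∧ e′) ⊩ (m M.∧ m′)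
        ⊩-∨    : ∀ {e e′ m m′} → e ⊩ m → e′ ⊩ m′ → (e ∨ e′) ⊩ (m M.∨ m′)
        ⊩-⊤    : ⊤ ⊩ M.⊤
        ⊩-⊥    : ⊥ ⊩ M.⊥
        ideal  : ∀ {e m} → I e → e ⊩ m → m M.∧ c₀ M.≤ M.⊥

    -- `h` picks the value supplied by `total`; `unique` then turns the closure properties of the
    -- graph into equations. Preimages chosen by `onto` lie in `I` whenever they should, which gives
    -- the second inclusion.
    reduces : ∀ {M c₀} → Representation M c₀ → ReducesTo M c₀
    reduces {M} {c₀} R = h , isOnto , a , b , image⊆ , ⊆image
      where
      module M = BoundedDistributiveLattice M
      open Representation R
      open import Relation.Binary.Lattice.Properties.MeetSemilattice M.meetSemilattice
        using () renaming (∧-monotonic to ∧ᴹ-monotonic)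

      h : Carrier → M.Carrier
      h = proj₁ ∘ total

      ⊩-h : ∀ e → e ⊩ h e
      ⊩-h = proj₂ ∘ total

      isOnto : IsOntoBoundedLatticeHomomorphism L M h
      isOnto = record
        { isLatticeHomomorphism = record
          { isRelHomomorphism = record { cong = λ {e} {e′} e≈e′ → unique e≈e′ (⊩-h e) (⊩-h e′) }
          ; ∧-homo = λ e e′ → unique Eq.refl (⊩-h _) (⊩-∧ (⊩-h e) (⊩-h e′))
          ; ∨-homo = λ e e′ → unique Eq.refl (⊩-h _) (⊩-∨ (⊩-h e) (⊩-h e′))
          }
        ; ⊤-homo = unique Eq.refl (⊩-h ⊤) ⊩-⊤
        ; ⊥-homo = unique Eq.refl (⊩-h ⊥) ⊩-⊥
        ; surjective = λ m → let e , e⊩m , _ = onto m in e , λ z≈e → unique z≈e (⊩-h _) e⊩m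
        }

      image⊆ : ∀ {m} → image L M h I m → m M.∧ c₀ M.≤ M.⊥
      image⊆ (e , e∈I , he≈m) =
        M.trans (∧ᴹ-monotonic (M.reflexive (M.Eq.sym he≈m)) M.refl) (ideal e∈I (⊩-h e))

      ⊆image : ∀ {m} → m M.∧ c₀ M.≤ M.⊥ → image L M h I m
      ⊆image {m} le = let e , e⊩m , e∈I = onto m in e , e∈I le , unique Eq.refl (⊩-h e) e⊩m

    -- The points `x`, `y`, `z n` form a copy of `Z₁`, and the trace of an element on them is a
    -- clopen upset: clopen by convergence, an upset by the inclusions.
    reduces₁ : (∀ {m n} → m < n → z n ⊆ z m) → ReducesTo L₁ c₁
    reduces₁ descending = reduces {M = L₁} {c₀ = c₁} record
      { _⊩_    = _⊩_
      ; total  = total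
      ; onto   = onto
      ; unique = λ e≈e′ i i′ p → trans (sym (i p)) (trans (≈-cong (point p) e≈e′) (i′ p))
      ; ⊩-∧    = λ i i′ p → trans (∧-homo (point p) _ _) (cong₂ Bool._∧_ (i p) (i′ p))
      ; ⊩-∨    = λ i i′ p → trans (∨-homo (point p) _ _) (cong₂ Bool._∨_ (i p) (i′ p))
      ; ⊩-⊤    = λ p → ⊤-homo (point p)
      ; ⊩-⊥    = λ p → ⊥-homo (point p)
      ; ideal  = λ {_} {m} e∈I i → λ where
          𝐱     → ∧false≤false (proj₁ m 𝐱)
          𝐲     → Bool.≤-reflexive (cong (Bool._∧ true) (trans (sym (i 𝐲)) (y∌I e∈I)))
          (𝐳 n) → ∧false≤false (proj₁ m (𝐳 n))
      }
      where
      module L₁ = BoundedDistributiveLattice L₁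

      point : Z₁ → PrimeFilter
      point 𝐱     = x
      point 𝐲     = y
      point (𝐳 n) = z n

      _⊩_ : Carrier → L₁.Carrier → Set
      e ⊩ (U , _) = ∀ p → char (point p) e ≡ U p

      -- An `e` in `x` lies in `z k` for some late `k` beyond `n`, and the chain descends.
      x⊆z : ∀ n → x ⊆ z n
      x⊆z n {e} i =
        let N , lim = z→x e
        in  descending (ℕ.m≤n⊔m N (suc n)) (trans (lim (ℕ.m≤m⊔n N (suc n))) i)

      total : ∀ e → ∃ λ m → e ⊩ m
      total e = (U , (open-U , closed-U) , up) , λ _ → refl
        where
        U : Z₁ → Bool
        U p = char (point p) e

        N : ℕ
        N = proj₁ (z→x e)

        z≡x : ∀ {n} → N ℕ.≤ n → U (𝐳 n) ≡ U 𝐱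
        z≡x = proj₂ (z→x e)

        open-U : Open U
        open-U t = bounded⇒finite-Z₁ N
          (eventually-false⇒bounded λ N≤n → cong not (trans (z≡x N≤n) (T⇒≡ t)))

        closed-U : Open (∁ U)
        closed-U t = bounded⇒finite-Z₁ N (eventually-false⇒bounded λ N≤n →
          trans (cong (not ∘ not) (z≡x N≤n)) (cong not (T⇒≡ t)))

        up : Upset U
        up ReflClosure.refl        = id
        up ReflClosure.[ 𝐱<𝐲 ]     = ≡⇒T ∘ x⊆y ∘ T⇒≡
        up ReflClosure.[ 𝐱<𝐳 ]     = ≡⇒T ∘ x⊆z _ ∘ T⇒≡
        up ReflClosure.[ 𝐳<𝐳 m<n ] = ≡⇒T ∘ descending m<n ∘ T⇒≡

      onto : ∀ m → ∃ λ e → e ⊩ m × (m L₁.∧ c₁ L₁.≤ L₁.⊥ → I e)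
      onto (U , (_ , closed-U) , up) with U 𝐱 in U𝐱
      -- As `𝐱` is the least point, an upset containing it is the whole space.
      ... | true  = ⊤ , (λ p → trans (⊤-homo (point p)) (sym (T⇒≡ (U-full p)))) ,
                    λ le → ⊥-elim (true≢false (T⇒≡ (U-full 𝐲)) (∧true≤false (le 𝐲)))
        where
        U-full : ∀ p → T (U p)
        U-full 𝐱     = ≡⇒T U𝐱
        U-full 𝐲     = up ReflClosure.[ 𝐱<𝐲 ] (≡⇒T U𝐱)
        U-full (𝐳 n) = up ReflClosure.[ 𝐱<𝐳 ] (≡⇒T U𝐱)
      -- Since `𝐱` is outside `U`, openness of the complement's complement condition `closed-U`
      -- makes `U` finite.
      ... | false =
        let N , below = finite⇒bounded index (closed-U _)
            e , z≡ , y≡ , x∌e , e∈I =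
              realise (U ∘ 𝐳) (λ n v → below {𝐳 n} (not-not v)) upset (U 𝐲)
        in  e , (λ { 𝐱 → trans x∌e (sym U𝐱) ; 𝐲 → y≡ ; (𝐳 n) → z≡ n }) ,
            λ le → e∈I (∧true≤false (le 𝐲))
        where
        upset : ∀ {m n} → z m ⊆ z n → U (𝐳 m) ≡ true → U (𝐳 n) ≡ true
        upset {m} {n} zm⊆zn v with ℕ.<-cmp m n
        -- Inclusion in a later point is refuted by `d m`, so only the order of `Z₁` remains.
        ... | tri< m<n _ _  = ⊥-elim (true≢false (zm⊆zn (z∋d m)) (z∌d m<n))
        ... | tri≈ _ refl _ = v
        ... | tri> _ _ n<m  = T⇒≡ (up ReflClosure.[ 𝐳<𝐳 n<m ] (≡⇒T v))

    -- Elements of `x` hold at every point and become the added top. Any other element holds at only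
    -- finitely many `z n`, by convergence.
    reduces₂ : Antichain → (∀ n → x ⊆ z n) → ReducesTo L₂ c₂
    reduces₂ anti x⊆z = reduces {M = L₂} {c₀ = c₂} record
      { _⊩_    = _⊩_
      ; total  = total
      ; onto   = onto
      ; unique = λ {_} {_} {m} {m′} → unique {m = m} {m′}
      ; ⊩-∧    = λ {_} {_} {m} {m′} → ⊩-∧ {m = m} {m′}
      ; ⊩-∨    = λ {_} {_} {m} {m′} → ⊩-∨ {m = m} {m′}
      ; ⊩-⊤    = ⊤-homo x
      ; ⊩-⊥    = ⊥-homo x , λ n → ⊥-homo (w n)
      ; ideal  = λ {_} {m} → ideal {m = m}
      }
      where
      module L₂ = BoundedDistributiveLattice L₂

      -- `y` receives index 0, so that `c₂` is its singleton, and the `z n` are shifted by one.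
      w : ℕ → PrimeFilter
      w zero    = y
      w (suc n) = z n

      x⊆w : ∀ n → x ⊆ w n
      x⊆w zero    = x⊆y
      x⊆w (suc n) = x⊆z n

      _⊩_ : Carrier → L₂.Carrier → Set
      e ⊩ ⊤⁺        = x ∋ e
      e ⊩ [ U , _ ] = x ∌ e × ∀ n → char (w n) e ≡ U n

      total : ∀ e → ∃ λ m → e ⊩ m
      total e with char x e in eq
      ... | true  = ⊤⁺ , eq
      ... | false = [ (λ n → char (w n) e) , bounded⇒finite (suc N) below ] , eq , λ _ → refl
        where
        N : ℕ
        N = proj₁ (z→x e)

        below : ∀ n → T (char (w n) e) → n < suc N
        below zero    _ = s≤s z≤n
        below (suc n) t = s≤s (eventually-false⇒bounded
          (λ {k} N≤k → trans (proj₂ (z→x e) N≤k) eq) n t)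

      onto : ∀ m → ∃ λ e → e ⊩ m × (m L₂.∧ c₂ L₂.≤ L₂.⊥ → I e)
      onto ⊤⁺ = ⊤ , ⊤-homo x , λ { [ le ] → ⊥-elim (true≢false refl (∧true≤false (le 0))) }
      onto [ U , fin ] =
        let N , below = finite⇒bounded id fin
            e , z≡ , y≡ , x∌e , e∈I =
              realise (U ∘ suc) (λ n v → ℕ.<-trans (ℕ.n<1+n n) (below (≡⇒T v)))
                      (λ le v → subst (λ k → U (suc k) ≡ true) (anti le) v) (U 0)
        in  e , (x∌e , λ { zero → y≡ ; (suc n) → z≡ n }) , λ { [ le ] → e∈I (∧true≤false (le 0)) }

      unique : ∀ {e e′ m m′} → e ≈ e′ → e ⊩ m → e′ ⊩ m′ → m L₂.≈ m′
      unique {m = ⊤⁺}    {⊤⁺}    _    _       _        = ⊤⁺≈⊤⁺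
      unique {m = ⊤⁺}    {[ _ ]} e≈e′ i       (o , _)  = ⊥-elim (true≢false (trans (sym (≈-cong x e≈e′)) i) o)
      unique {m = [ _ ]} {⊤⁺}    e≈e′ (o , _) i        = ⊥-elim (true≢false i (trans (sym (≈-cong x e≈e′)) o))
      unique {m = [ _ ]} {[ _ ]} e≈e′ (_ , i) (_ , i′) =
        [ (λ n → trans (sym (i n)) (trans (≈-cong (w n) e≈e′) (i′ n))) ]

      ⊩-∧ : ∀ {e e′ m m′} → e ⊩ m → e′ ⊩ m′ → (e ∧ e′) ⊩ (m L₂.∧ m′)
      ⊩-∧ {m = ⊤⁺}            {⊤⁺}    i       i′        = ∋-∧⁺ x i i′
      ⊩-∧ {m = ⊤⁺}            {[ _ ]} i       (o′ , i′) =
        ∌-downward x (x∧y≤y _ _) o′ ,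
        λ n → trans (∧-homo (w n) _ _) (cong₂ Bool._∧_ (x⊆w n i) (i′ n))
      ⊩-∧ {m = [ U , _ ]}     {⊤⁺}    (o , i) i′        =
        ∌-downward x (x∧y≤x _ _) o ,
        λ n → trans (∧-homo (w n) _ _)
                    (trans (cong₂ Bool._∧_ (i n) (x⊆w n i′)) (Bool.∧-identityʳ (U n)))
      ⊩-∧ {m = [ _ ]}         {[ _ ]} (o , i) (_ , i′)  =
        ∌-downward x (x∧y≤x _ _) o ,
        λ n → trans (∧-homo (w n) _ _) (cong₂ Bool._∧_ (i n) (i′ n))

      ⊩-∨ : ∀ {e e′ m m′} → e ⊩ m → e′ ⊩ m′ → (e ∨ e′) ⊩ (m L₂.∨ m′)
      ⊩-∨ {m = ⊤⁺}            i       _         = ∋-∨⁺ˡ x i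
      ⊩-∨ {m = [ _ ]} {⊤⁺}    _       i′        = ∋-∨⁺ʳ x i′
      ⊩-∨ {m = [ _ ]} {[ _ ]} (o , i) (o′ , i′) =
        trans (∨-homo x _ _) (cong₂ Bool._∨_ o o′) ,
        λ n → trans (∨-homo (w n) _ _) (cong₂ Bool._∨_ (i n) (i′ n))

      ideal : ∀ {e m} → I e → e ⊩ m → m L₂.∧ c₂ L₂.≤ L₂.⊥
      ideal {m = ⊤⁺}        e∈I i       = ⊥-elim (true≢false i (x∌ (y∌I e∈I)))
      ideal {m = [ U , _ ]} e∈I (_ , i) = [ (λ where
        zero    → Bool.≤-reflexive (cong (Bool._∧ true) (trans (sym (i 0)) (y∌I e∈I)))
        (suc n) → ∧false≤false (U (suc n))) ]

    -- The first coordinate is the trace on the `z n`, the second the value at `y`. Membership in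
    -- `x` can be read off: the trace is cofinite when `x` contains the element and finite
    -- otherwise. The condition on pairs reflects `x ⊆ y`.
    reduces₃ : Antichain → (∀ n → ¬ x ⊆ z n) → ReducesTo L₃ c₃
    reduces₃ anti x⊈z = reduces {M = L₃} {c₀ = c₃} record
      { _⊩_    = _⊩_
      ; total  = total
      ; onto   = onto
      ; unique = λ e≈e′ (i , j) (i′ , j′) →
          (λ n → trans (sym (i n)) (trans (≈-cong (z n) e≈e′) (i′ n))) ,
          trans (sym j) (trans (≈-cong y e≈e′) j′)
      ; ⊩-∧    = λ (i , j) (i′ , j′) →
          (λ n → trans (∧-homo (z n) _ _) (cong₂ Bool._∧_ (i n) (i′ n))) ,
          trans (∧-homo y _ _) (cong₂ Bool._∧_ j j′)
      ; ⊩-∨    = λ (i , j) (i′ , j′) →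
          (λ n → trans (∨-homo (z n) _ _) (cong₂ Bool._∨_ (i n) (i′ n))) ,
          trans (∨-homo y _ _) (cong₂ Bool._∨_ j j′)
      ; ⊩-⊤    = (λ n → ⊤-homo (z n)) , ⊤-homo y
      ; ⊩-⊥    = (λ n → ⊥-homo (z n)) , ⊥-homo y
      ; ideal  = λ { {_} {((A , _) , _) , _} e∈I (_ , j) →
          (λ n → ∧false≤false (A n)) ,
          Bool.≤-reflexive (cong (Bool._∧ true) (trans (sym j) (y∌I e∈I))) }
      }
      where
      module L₃ = BoundedDistributiveLattice L₃

      _⊩_ : Carrier → L₃.Carrier → Set
      e ⊩ (((A , _) , v) , _) = (∀ n → char (z n) e ≡ A n) × char y e ≡ v

      total : ∀ e → ∃ λ m → e ⊩ m
      total e with char x e in eq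
      ... | true  = ((((λ n → char (z n) e) , inj₂ cofin) , char y e) , inj₂ (x⊆y eq))
                  , (λ _ → refl) , refl
        where
        cofin : Cofinite (λ n → char (z n) e)
        cofin = let N , lim = z→x e in
          bounded⇒finite N (eventually-false⇒bounded λ N≤n → cong not (trans (lim N≤n) eq))
      ... | false = ((((λ n → char (z n) e) , inj₁ fin) , char y e) , inj₁ fin)
                  , (λ _ → refl) , refl
        where
        fin : Finite (λ n → char (z n) e)
        fin = let N , lim = z→x e in
          bounded⇒finite N (eventually-false⇒bounded λ N≤n → trans (lim N≤n) eq)

      realise-finite : ∀ {A : ℕ → Bool} {v} → Finite A →
        ∃ λ e → ((∀ n → char (z n) e ≡ A n) × char y e ≡ v) × (v ≡ false → I e)
      realise-finite {A} {v} fin =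
        let N , below = finite⇒bounded id fin
            e , z≡ , y≡ , _ , e∈I =
              realise A (λ n i → below (≡⇒T i))
                      (λ le i → subst (λ k → A k ≡ true) (anti le) i) v
        in  e , (z≡ , y≡) , e∈I

      onto : ∀ m → ∃ λ e → e ⊩ m × (m L₃.∧ c₃ L₃.≤ L₃.⊥ → I e)
      onto (((A , _) , v) , inj₁ fin) =
        let e , e⊩m , e∈I = realise-finite fin in e , e⊩m , λ (_ , le) → e∈I (∧true≤false le)
      -- The two alternatives defining `L₃` overlap: a finite `A` may also come with second
      -- coordinate 1.
      onto (((A , inj₁ fin) , .true) , inj₂ refl) =
        let e , e⊩m , _ = realise-finite fin in e , e⊩m , λ { (_ , ()) }
      onto (((A , inj₂ cofin) , .true) , inj₂ refl) =
        let N , below = finite⇒bounded id cofin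
            e , z≡ , y∋e = realise-cofinite anti x⊈z A N λ {n} N≤n → Bool.¬-not λ A≡false →
              ℕ.<⇒≱ (below {n} (≡⇒T (cong not A≡false))) N≤n
        in  e , (z≡ , y∋e) , λ { (_ , ()) }

  -- Choice of the quotient by Ramsey's theorem.

  ReducesToSome : Set (c ⊔ˡ ℓ₁ ⊔ˡ ℓ₂)
  ReducesToSome = ∃ λ i → ∃ λ h → IsOntoBoundedLatticeHomomorphism L (𝕃 i) h ×
    (∃₂ λ a b → image L (𝕃 i) h (Ideal L a b) ≐
                Ideal (𝕃 i) (𝕔 i) (BoundedDistributiveLattice.⊥ (𝕃 i)))

  configuration⇒reduces : Configuration → ReducesToSome
  configuration⇒reduces C with ramsey (λ m n → Configuration.z C n ⊆ Configuration.z C m)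
  ... | f , f-inc , inj₁ descending =
    Fin.zero , Realisation.reduces₁ (subsequence f-inc C) descending
  -- This relation ignores its second argument, so here Ramsey's theorem acts as the infinite
  -- pigeonhole principle; `n < suc n` below only supplies a dummy second index.
  ... | f , f-inc , inj₂ ⊈ with ramsey (λ m _ → Configuration.x C ⊆ Configuration.z C (f m))
  ...   | g , g-inc , inj₁ x⊆z = Fin.suc Fin.zero ,
                                 reduces₂ (antichain (⊈ ∘ g-inc)) (λ n → x⊆z (ℕ.n<1+n n))
    where open Realisation (subsequence g-inc (subsequence f-inc C))
  ...   | g , g-inc , inj₂ x⊈z = Fin.suc (Fin.suc Fin.zero) ,
                                 reduces₃ (antichain (⊈ ∘ g-inc)) (λ n → x⊈z (ℕ.n<1+n n))
    where open Realisation (subsequence g-inc (subsequence f-inc C))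

  principal⇒heyting : (∀ a b → Greatest L (Ideal L a b)) → IsHeyting L
  principal⇒heyting principal = (λ a b → proj₁ (principal a b)) , record
    { isBoundedLattice = isBoundedLattice
    ; exponential      = λ w a b →
        let _ , m∈I , greatest = principal a b
        in  greatest , λ w≤m → ideal-downward a b w≤m m∈I
    }

  ¬heyting⇒reduces : ¬ IsHeyting L → ReducesToSome
  ¬heyting⇒reduces ¬heyting =
    let a , ¬∀  = ¬∀⇒∃¬ (¬heyting ∘ principal⇒heyting)
        b , ¬pr = ¬∀⇒∃¬ ¬∀
    in  configuration⇒reduces (FromLimitPoint.configuration (limitPoint ¬pr))

-- The converse: greatest elements of ideals and their images.

heyting⇒greatest :
  ∀ {c ℓ₁ ℓ₂ d e₁ e₂} (L : BoundedDistributiveLattice c ℓ₁ ℓ₂)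
  (M : BoundedDistributiveLattice d e₁ e₂) {h} → IsHeyting L →
  IsOntoBoundedLatticeHomomorphism L M h → ∀ {a b} {P : Pred _ p} →
  image L M h (Ideal L a b) ≐ P → Greatest M P
heyting⇒greatest L M {h} (_⇨_ , isHeyting) hom {a} {b} (image⊆P , P⊆image) =
  -- `a ⇨ b` is the greatest element of `I_{a→b}`, and a monotone map carries it to the greatest
  -- element of the image.
  h (a ⇨ b) , image⊆P (a ⇨ b , transpose-∧ L.refl , M.Eq.refl) , λ w∈P →
    let e , e∈I , he≈w = P⊆image w∈P
    in  M.trans (M.reflexive (M.Eq.sym he≈w)) (h-mono (transpose-⇨ e∈I))
  where
  module L = BoundedDistributiveLattice L
  module M = BoundedDistributiveLattice M
  open IsHeytingAlgebra isHeyting using (transpose-∧; transpose-⇨)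
  open IsOntoBoundedLatticeHomomorphism hom

  h-mono : ∀ {e e′} → e L.≤ e′ → h e M.≤ h e′
  h-mono {e} {e′} e≤e′ =
    M.trans (M.reflexive (M.Eq.trans
      (⟦⟧-cong (L.antisym (L.∧-greatest L.refl e≤e′) (L.x∧y≤x e e′))) (∧-homo e e′)))
      (M.x∧y≤y (h e) (h e′))

singleton : ℕ → ℕ → Bool
singleton n k = k ℕ.≡ᵇ n

finite-singleton : ∀ n → Finite (singleton n)
finite-singleton n = n ∷ [] , λ {k} t → here (ℕ.≡ᵇ⇒≡ k n t)

singleton∋ : ∀ n → singleton n n ≡ true
singleton∋ n = T⇒≡ (ℕ.≡⇒≡ᵇ n n refl)

-- A member of the ideal contains only finitely many points of the sequence, and the ideal always
-- has a member reaching a further one: a principal upset in `L₁`, a singleton in `L₂` and `L₃`.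
no-greatest : ∀ i → ¬ Greatest (𝕃 i) (Ideal (𝕃 i) (𝕔 i) (BoundedDistributiveLattice.⊥ (𝕃 i)))
no-greatest Fin.zero ((U , (_ , closed-U) , up) , U∈I , greatest) =
  ℕ.<-irrefl refl (below {𝐳 N} (not-not U∋𝐳N))
  where
  -- An upset containing `𝐱` contains `𝐲` and thus meets `c₁`.
  U∌𝐱 : U 𝐱 ≡ false
  U∌𝐱 = Bool.¬-not λ U∋𝐱 →
    true≢false (T⇒≡ (up ReflClosure.[ 𝐱<𝐲 ] (≡⇒T U∋𝐱))) (∧true≤false (U∈I 𝐲))

  bounded : ∃ λ N → ∀ {q} → T (∁ (∁ U) q) → index q < N
  bounded = finite⇒bounded index (closed-U (≡⇒T (cong not U∌𝐱)))

  N : ℕ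
  N = proj₁ bounded

  below : ∀ {q} → T (∁ (∁ U) q) → index q < N
  below = proj₂ bounded

  ↑𝐳N : Z₁ → Bool
  ↑𝐳N 𝐱     = false
  ↑𝐳N 𝐲     = false
  ↑𝐳N (𝐳 k) = k ℕ.≤ᵇ N

  closed : Open (∁ ↑𝐳N)
  closed _ = bounded⇒finite-Z₁ (suc N) λ n t → s≤s (ℕ.≤ᵇ⇒≤ n N (≡⇒T (double (T⇒≡ t))))
    where
    double : ∀ {b} → not (not b) ≡ true → b ≡ true
    double {true} _ = refl

  upset : Upset ↑𝐳N
  upset ReflClosure.refl          t = t
  upset ReflClosure.[ 𝐳<𝐳 m<n ] t = ℕ.≤⇒≤ᵇ (ℕ.≤-trans (ℕ.<⇒≤ m<n) (ℕ.≤ᵇ⇒≤ _ N t))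

  U∋𝐳N : U (𝐳 N) ≡ true
  U∋𝐳N = true≤⇒≡ (subst (Bool._≤ U (𝐳 N)) (T⇒≡ (ℕ.≤⇒≤ᵇ (ℕ.≤-refl {N})))
    (greatest {↑𝐳N , ((λ ()) , closed) , upset}
      (λ { 𝐱 → Bool.b≤b ; 𝐲 → Bool.b≤b ; (𝐳 k) → ∧false≤false (k ℕ.≤ᵇ N) }) (𝐳 N)))
no-greatest (Fin.suc Fin.zero) (⊤⁺ , [ ⊤∧c≤⊥ ] , _) =
  true≢false refl (∧true≤false (⊤∧c≤⊥ 0))
no-greatest (Fin.suc Fin.zero) ([ U , fin ] , _ , greatest) = contra
  -- `suc N` rather than `N`, because `N` may be 0 and the singleton of 0 is `c₂` itself.
  (greatest {[ singleton (suc N) , finite-singleton (suc N) ]}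
    [ (λ { zero → Bool.b≤b ; (suc k) → ∧false≤false (singleton (suc N) (suc k)) }) ])
  where
  bounded : ∃ λ N → ∀ {n} → T (U n) → n < N
  bounded = finite⇒bounded id fin

  N : ℕ
  N = proj₁ bounded

  contra : ¬ [ singleton (suc N) , finite-singleton (suc N) ] ≤⁺ [ U , fin ]
  contra [ le ] = ℕ.<-irrefl refl (ℕ.<-trans (ℕ.n<1+n N) (proj₂ bounded (≡⇒T
    (true≤⇒≡ (subst (Bool._≤ U (suc N)) (singleton∋ (suc N)) (le (suc N)))))))
-- A pair with second coordinate 1 meets `c₃`, so the first coordinate of a member of the ideal is
-- finite.
no-greatest (Fin.suc (Fin.suc Fin.zero)) ((_ , inj₂ refl) , (_ , ()) , _)
no-greatest (Fin.suc (Fin.suc Fin.zero)) ((((A , _) , _) , inj₁ fin) , _ , greatest) =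
  ℕ.<-irrefl refl (proj₂ bounded (≡⇒T
    (true≤⇒≡ (subst (Bool._≤ A N) (singleton∋ N) (proj₁ (greatest {w} w∈I) N)))))
  where
  bounded : ∃ λ N → ∀ {n} → T (A n) → n < N
  bounded = finite⇒bounded id fin

  N : ℕ
  N = proj₁ bounded

  w : BoundedDistributiveLattice.Carrier L₃
  w = ((singleton N , inj₁ (finite-singleton N)) , false) , inj₁ (finite-singleton N)

  w∈I : Ideal L₃ c₃ (BoundedDistributiveLattice.⊥ L₃) w
  w∈I = (λ n → ∧false≤false (singleton N n)) , Bool.b≤b

theorem3p3 : (∀ {ℓ} → ExcludedMiddle ℓ) →
    ∀ {c ℓ₁ ℓ₂} (L : BoundedDistributiveLattice c ℓ₁ ℓ₂) → Countable L →
    (¬ IsHeyting L) ⇔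
    (∃ λ i → ∃ λ h → IsOntoBoundedLatticeHomomorphism L (𝕃 i) h ×
    (∃₂ λ a b → image L (𝕃 i) h (Ideal L a b) ≐
    Ideal (𝕃 i) (𝕔 i) (BoundedDistributiveLattice.⊥ (𝕃 i))))
theorem3p3 em L countable = mk⇔
  (CountableLattice.¬heyting⇒reduces em L countable)
  (λ (i , _ , hom , _ , _ , image≐I) heyting →
    no-greatest i (heyting⇒greatest L (𝕃 i) heyting hom image≐I))
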